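{- Let $\ell\ge 2$, let $t_1,\dots,t_{\ell-1}$ and $s$ be positive integers, let $V=\{2s,\,2(s+t_1),\,\dots,\,2(s+t_1+\cdots+t_{\ell-1})\}$ and let $m\ge\max(V)$ be an integer. Put $p=\frac{m}{2}$ if $m$ is even and $p=m$ if $m$ is odd. If the sequence $(t_1,\dots,t_{\ell-1})$ is primitive, then the sequence $H(D^{(m,V)})$ is periodic with a period of either $p$ or $2p$. Moreover, the periodicity is $p$ if $\prod_{j=1}^{\ell-2}h(t_1,\dots,t_j)=-1$, and is $2p$ if $\prod_{j=1}^{\ell-2}h(t_1,\dots,t_j)=1$.
   Context: For an integer $m\ge 2$ and $V\subseteq[m]=\{1,\dots,m\}$, let $(m,V)=\{k\in\mathbb{Z}^+ : k\equiv j \pmod m \text{ for some } j\in V\}$. A Dyck path of size $n$ is a lattice path from $(0,0)$ to $(2n,0)$ with steps $(1,1)$ and $(1,-1)$ never going below the $x$-axis; a peak is an up-step immediately followed by a down-step, and its height is the $y$-coordinate of the point between them. Let $d_n^{(m,V)}$ be the number of Dyck paths of size $n$ none of whose peaks has height in $(m,V)$, and $D^{(m,V)}(x)=\sum_{n\ge0}d_n^{(m,V)}x^n$. For a power series $F=\sum f_nx^n$ and $n\ge1$, $H_n(F)=\det(f_{i+j})_{0\le i,j\le n-1}$ and $H(F)=(H_1(F),H_2(F),\dots)$. A sequence $(a_n)_{n\ge1}$ has period $q$ if $a_{n+q}=a_n$ for all $n\ge1$. For positive integers $t_1,t_2,\dots$ define rationals $h(t_1)=2-t_1$ and $h(t_1,\dots,t_j)=2-t_j-1/h(t_1,\dots,t_{j-1})$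 for $j\ge2$. A sequence $(t_1,\dots,t_b)$ ($b\ge0$) of positive integers is admissible if $h(t_1),h(t_1,t_2),\dots,h(t_1,\dots,t_b)$ are all nonzero (the empty sequence is admissible). A sequence $(t_1,\dots,t_{b+1})$ of positive integers is primitive if $(t_1,\dots,t_b)$ is admissible and $h(t_1,\dots,t_{b+1})=2-t_{b+1}-1/h(t_1,\dots,t_b)=0$. (An empty product equals $1$.) -}

module Defs where

open import Data.Bool using (Bool; true; false; _∧_; _∨_; if_then_else_; not)
open import Data.Nat as ℕ using (ℕ; zero; suc; _≡ᵇ_; _≤_)
open import Data.Nat using (_/_; _%_)
open import Data.Integer as ℤ using (ℤ)
open import Data.Rational as ℚ using (ℚ; 0ℚ; 1ℚ)
open import Data.Rational.Properties using () renaming (_≟_ to _≟ℚ_)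
open import Data.Fin using (Fin; toℕ; punchIn) renaming (zero to fzero; suc to fsuc)
open import Data.List using (List; []; _∷_; map; foldr; upTo; allFin; length; take; filter)
open import Data.Bool.ListAction using (any)
open import Data.Nat.ListAction using (sum)
open import Relation.Nullary using (yes; no; ¬_)
open import Relation.Binary.PropositionalEquality using (_≡_; _≢_)
open import Data.Product using (Σ; _×_)
open import Data.List using (_∷ʳ_)

-- Dyck paths.  A step is a Bool: true = up-step (1,1), false = down-step (1,-1).

allPaths : ℕ → List (List Bool)
allPaths zero = [] ∷ []
allPaths (suc k) = map (true ∷_) (allPaths k) Data.List.++ map (false ∷_) (allPaths k)

isDyckFrom : ℕ → List Bool → Bool
isDyckFrom h [] = h ≡ᵇ 0
isDyckFrom h (true ∷ xs) = isDyckFrom (suc h) xs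
isDyckFrom zero (false ∷ xs) = false
isDyckFrom (suc h) (false ∷ xs) = isDyckFrom h xs

peakHeightsFrom : ℕ → List Bool → List ℕ
peakHeightsFrom h [] = []
peakHeightsFrom h (true ∷ false ∷ xs) = suc h ∷ peakHeightsFrom (suc h) (false ∷ xs)
peakHeightsFrom h (true ∷ xs) = peakHeightsFrom (suc h) xs
peakHeightsFrom h (false ∷ xs) = peakHeightsFrom (ℕ.pred h) xs

-- congruence modulo m (only used for m ≥ 2)
congMod : ℕ → ℕ → ℕ → Bool
congMod zero a b = a ≡ᵇ b
congMod (suc m) a b = (a % suc m) ≡ᵇ (b % suc m)

inMV : ℕ → List ℕ → ℕ → Bool
inMV m V zero = false
inMV m V (suc k) = any (congMod m (suc k)) V

avoids : ℕ → List ℕ → List Bool → Bool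
avoids m V xs = not (any (inMV m V) (peakHeightsFrom 0 xs))

d : ℕ → List ℕ → ℕ → ℕ
d m V n = length (filter (λ xs → isDyckFrom 0 xs Data.Bool.≟ true)
                   (filter (λ xs → avoids m V xs Data.Bool.≟ true) (allPaths (2 ℕ.* n))))

sumℤ : List ℤ → ℤ
sumℤ = foldr ℤ._+_ (ℤ.+ 0)

det : (n : ℕ) → (Fin n → Fin n → ℤ) → ℤ
det zero M = ℤ.+ 1
det (suc n) M =
  sumℤ (map (λ j → (ℤ.- ℤ.+ 1) ℤ.^ toℕ j ℤ.* M fzero j ℤ.* det n (λ i k → M (fsuc i) (punchIn j k)))
            (allFin (suc n)))

hankel : (ℕ → ℤ) → ℕ → ℤ
hankel f n = det n (λ i j → f (toℕ i ℕ.+ toℕ j))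

-- the sequence H(D^{(m,V)}) (meaningful for n ≥ 1)
HD : ℕ → List ℕ → ℕ → ℤ
HD m V = hankel (λ k → ℤ.+ d m V k)

HasPeriod : (ℕ → ℤ) → ℕ → Set
HasPeriod a q = ∀ n → 1 ≤ n → a (n ℕ.+ q) ≡ a n

ℕtoℚ : ℕ → ℚ
ℕtoℚ t = ℤ.+ t ℚ./ 1

-- 1/x, made total by setting 1/0 := 0 (only ever used at nonzero x below,
-- since the relevant prefix values are required to be nonzero)
inv : ℚ → ℚ
inv x with x ≟ℚ 0ℚ
... | yes _ = 0ℚ
... | no x≢0 = ℚ.1/_ x {{ℚ.≢-nonZero x≢0}}

two : ℚ
two = ℕtoℚ 2

hGo : ℚ → List ℕ → ℚ
hGo x [] = x
hGo x (t ∷ ts) = hGo (two ℚ.- ℕtoℚ t ℚ.- inv x) ts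

-- h(t_1,...,t_j); h of the empty list is never used (set to 0)
h : List ℕ → ℚ
h [] = 0ℚ
h (t ∷ ts) = hGo (two ℚ.- ℕtoℚ t) ts

Admissible : List ℕ → Set
Admissible u = ∀ j → 1 ≤ j → j ≤ length u → h (take j u) ≢ 0ℚ

Primitive : List ℕ → Set
Primitive ts = Σ (List ℕ) λ u → Σ ℕ λ t → (ts ≡ u ∷ʳ t) × Admissible u × (h (u ∷ʳ t) ≡ 0ℚ)

prodH : List ℕ → ℚ
prodH ts = foldr ℚ._*_ 1ℚ (map (λ i → h (take (suc i) ts)) (upTo (length ts ℕ.∸ 1)))

Vset : ℕ → List ℕ → List ℕ
Vset s ts = map (λ i → 2 ℕ.* (s ℕ.+ sum (take i ts))) (upTo (suc (length ts)))

pOf : ℕ → ℕ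
pOf m = if (m % 2) ≡ᵇ 0 then m / 2 else m

{-# OPTIONS --safe #-}
module Submission where

-- Write a Dyck path of length 2i + 2j as two half paths meeting at height 2k. With A k and B k denoting
-- x^k times the generating functions of the half paths from heights 2k and 2k - 1, this expresses the
-- Hankel matrix as the sum of A k ⊗ A k over all k, minus B k ⊗ B k for each forbidden height 2k, since a
-- peak at the meeting point must be discarded. As long as no odd height is forbidden, A k = B k + B (k+1),
-- so in the basis B the Hankel form is tridiagonal with off-diagonal entries 1 and diagonal entries
-- 1, 2 - β 1, 2 - β 2, …, where β k ∈ {0, 1} tells whether 2k is forbidden. Its leading minors are, at the
-- forbidden heights, combinations of the products of the h(t₁,…,t_j); primitivity says that the form of
-- the levels up to r = s + t₁ + ⋯ is degenerate, so B r can be eliminated. Beyond level r the A k are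
-- orthonormal up to level p, where everything repeats. The basis is unitriangular, hence
-- H_{n+p} = ε H_n with ε = - ∏_{j≤ℓ-2} h(t₁,…,t_j), and this product is a unit because consecutive
-- continuants are coprime.

-- The first `r` levels involve the `r + 1` vectors `B 0`, ..., `B r`, one more than the indices
-- they may occupy if the free levels are to start at index `r`. In their form the last diagonal
-- entry is `1 - β r`, as only one of the two levels touching `B r` is included; so its determinant
-- is `leading β (suc r) - leading β r`. When this vanishes and `leading β r` is a unit, there is an
-- integral kernel vector with last coordinate 1, and `B r` can be absorbed by a unitriangular
-- change of basis. Between forbidden heights the minors form an arithmetic progression whose slope
-- changes only at a forbidden height; the values of `h` are the quotients of successive slopes. For
-- odd m there are forbidden odd heights, but all lie above m, which is at least `2r`. They never
-- meet the levels where `A k` is rewritten through `B k`, and the free levels use `A k` itself.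

open import Defs

-- Finite sums over initial segments of ℕ.

module FiniteSums where

  open import Data.Nat using (ℕ; zero; suc; _<_; s≤s; z≤n)
  import Data.Nat as ℕ
  open import Data.Integer using (ℤ; _+_; _*_; -_; 0ℤ; -1ℤ)
  import Data.Integer.Properties as ℤ
  open import Data.Integer.Tactic.RingSolver using (solve-∀)
  open import Function using (_∘_)
  open import Relation.Binary.PropositionalEquality
  open ≡-Reasoning

  abstract
    ∑ : ℕ → (ℕ → ℤ) → ℤ
    ∑ zero f = 0ℤ
    ∑ (suc n) f = f 0 + ∑ n (f ∘ suc)

    ∑-zero : ∀ f → ∑ 0 f ≡ 0ℤ
    ∑-zero f = refl

    ∑-suc : ∀ n f → ∑ (suc n) f ≡ f 0 + ∑ n (f ∘ suc)
    ∑-suc n f = refl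

    ∑-cong-< : ∀ n {f g : ℕ → ℤ} → (∀ i → i < n → f i ≡ g i) → ∑ n f ≡ ∑ n g
    ∑-cong-< zero eq = refl
    ∑-cong-< (suc n) eq = cong₂ _+_ (eq 0 (s≤s z≤n)) (∑-cong-< n λ i i<n → eq (suc i) (s≤s i<n))

    ∑-distrib-+ : ∀ n f g → ∑ n (λ i → f i + g i) ≡ ∑ n f + ∑ n g
    ∑-distrib-+ zero f g = refl
    ∑-distrib-+ (suc n) f g =
      trans (cong (f 0 + g 0 +_) (∑-distrib-+ n (f ∘ suc) (g ∘ suc))) (interchange (f 0) (g 0) _ _)
      where
      interchange : ∀ a b c d → a + b + (c + d) ≡ (a + c) + (b + d)
      interchange = solve-∀

    ∑-distribˡ-* : ∀ n c f → c * ∑ n f ≡ ∑ n (λ i → c * f i)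
    ∑-distribˡ-* zero c f = ℤ.*-zeroʳ c
    ∑-distribˡ-* (suc n) c f =
      trans (ℤ.*-distribˡ-+ c (f 0) _) (cong (c * f 0 +_) (∑-distribˡ-* n c (f ∘ suc)))

    ∑-const-0 : ∀ n → ∑ n (λ _ → 0ℤ) ≡ 0ℤ
    ∑-const-0 zero = refl
    ∑-const-0 (suc n) = trans (ℤ.+-identityˡ _) (∑-const-0 n)

  ∑-cong : ∀ n {f g : ℕ → ℤ} → (∀ i → f i ≡ g i) → ∑ n f ≡ ∑ n g
  ∑-cong n eq = ∑-cong-< n λ i _ → eq i

  ∑-vanish : ∀ n {f : ℕ → ℤ} → (∀ i → f i ≡ 0ℤ) → ∑ n f ≡ 0ℤ
  ∑-vanish n eq = trans (∑-cong n eq) (∑-const-0 n)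

  ∑-neg : ∀ n f → ∑ n (λ i → - f i) ≡ - ∑ n f
  ∑-neg n f = begin
    ∑ n (λ i → - f i)                ≡⟨ ∑-cong n (λ i → ℤ.-1*i≡-i (f i)) ⟨
    ∑ n (λ i → -1ℤ * f i) ≡⟨ ∑-distribˡ-* n -1ℤ f ⟨
    -1ℤ * ∑ n f         ≡⟨ ℤ.-1*i≡-i (∑ n f) ⟩
    - ∑ n f ∎

  ∑-one : ∀ f → ∑ 1 f ≡ f 0
  ∑-one f = trans (∑-suc 0 f) (trans (cong (f 0 +_) (∑-zero _)) (ℤ.+-identityʳ (f 0)))

  ∑-comm : ∀ m n (f : ℕ → ℕ → ℤ) → ∑ m (λ i → ∑ n (f i)) ≡ ∑ n (λ j → ∑ m (λ i → f i j))
  ∑-comm zero n f = trans (∑-zero _) (sym (∑-vanish n λ j → ∑-zero _))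
  ∑-comm (suc m) n f = begin
    ∑ (suc m) (λ i → ∑ n (f i))
      ≡⟨ ∑-suc m _ ⟩
    ∑ n (f 0) + ∑ m (λ i → ∑ n (f (suc i)))
      ≡⟨ cong (∑ n (f 0) +_) (∑-comm m n (f ∘ suc)) ⟩
    ∑ n (f 0) + ∑ n (λ j → ∑ m (λ i → f (suc i) j))
      ≡⟨ ∑-distrib-+ n _ _ ⟨
    ∑ n (λ j → f 0 j + ∑ m (λ i → f (suc i) j))
      ≡⟨ ∑-cong n (λ j → ∑-suc m _) ⟨
    ∑ n (λ j → ∑ (suc m) (λ i → f i j)) ∎

  ∑-split : ∀ m n f → ∑ (m ℕ.+ n) f ≡ ∑ m f + ∑ n (λ i → f (m ℕ.+ i))
  ∑-split zero n f = trans (sym (ℤ.+-identityˡ _)) (cong (_+ ∑ n f) (sym (∑-zero f)))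
  ∑-split (suc m) n f = begin
    ∑ (suc m ℕ.+ n) f                                    ≡⟨ ∑-suc (m ℕ.+ n) f ⟩
    f 0 + ∑ (m ℕ.+ n) (f ∘ suc)                          ≡⟨ cong (f 0 +_) (∑-split m n (f ∘ suc)) ⟩
    f 0 + (∑ m (f ∘ suc) + ∑ n (λ i → f (suc m ℕ.+ i)))  ≡⟨ ℤ.+-assoc (f 0) _ _ ⟨
    f 0 + ∑ m (f ∘ suc) + ∑ n (λ i → f (suc m ℕ.+ i))    ≡⟨ cong (_+ ∑ n (λ i → f (suc m ℕ.+ i))) (∑-suc m f) ⟨
    ∑ (suc m) f + ∑ n (λ i → f (suc m ℕ.+ i)) ∎

  ∑-last : ∀ n f → ∑ (suc n) f ≡ ∑ n f + f n
  ∑-last zero f = begin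
    ∑ 1 f           ≡⟨ ∑-suc 0 f ⟩
    f 0 + ∑ 0 _     ≡⟨ ℤ.+-comm (f 0) _ ⟩
    ∑ 0 (f ∘ suc) + f 0 ≡⟨ cong (_+ f 0) (trans (∑-zero _) (sym (∑-zero f))) ⟩
    ∑ 0 f + f 0 ∎
  ∑-last (suc n) f = begin
    ∑ (2 ℕ.+ n) f                       ≡⟨ ∑-suc (suc n) f ⟩
    f 0 + ∑ (suc n) (f ∘ suc)           ≡⟨ cong (f 0 +_) (∑-last n (f ∘ suc)) ⟩
    f 0 + (∑ n (f ∘ suc) + f (suc n))   ≡⟨ ℤ.+-assoc (f 0) _ _ ⟨
    f 0 + ∑ n (f ∘ suc) + f (suc n)     ≡⟨ cong (_+ f (suc n)) (∑-suc n f) ⟨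
    ∑ (suc n) f + f (suc n) ∎

-- Determinants: expansions, row operations, unitriangular congruence.

module Determinants where

  open FiniteSums
  open import Data.Nat using (ℕ; zero; suc; 2+; _<_; s≤s; z≤n)
  open import Data.Fin using (Fin; zero; suc; toℕ; punchIn)
  open import Data.Integer using (ℤ; _+_; _*_; -_; _^_; 0ℤ; 1ℤ; -1ℤ)
  open import Data.Integer.Properties
  open import Data.Integer.Tactic.RingSolver using (solve-∀)
  open import Data.List using (foldr; tabulate)
  open import Data.List.Properties using (map-tabulate)
  open import Data.Product using (_×_; _,_)
  open import Function using (id; _∘_)
  open import Relation.Binary.PropositionalEquality
  open ≡-Reasoning

  -- Matrices are indexed by ℕ; only the top left n × n block matters for Det n.
  Matrix : Set
  Matrix = ℕ → ℕ → ℤ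

  sgn : ℕ → ℤ
  sgn k = -1ℤ ^ k

  skip : ℕ → ℕ → ℕ
  skip zero k = suc k
  skip (suc j) zero = zero
  skip (suc j) (suc k) = suc (skip j k)

  minor : ℕ → ℕ → Matrix → Matrix
  minor i j M r k = M (skip i r) (skip j k)

  infixr 5 _◂_
  _◂_ : ∀ {A : Set} → A → (ℕ → A) → ℕ → A
  (a ◂ Y) zero = a
  (a ◂ Y) (suc i) = Y i

  abstract
    Det : ℕ → Matrix → ℤ
    Det zero M = 1ℤ
    Det (suc n) M = ∑ (suc n) (λ j → sgn j * M 0 j * Det n (minor 0 j M))

    Det-zero : ∀ M → Det 0 M ≡ 1ℤ
    Det-zero M = refl

    row-expansion : ∀ n M → Det (suc n) M ≡ ∑ (suc n) (λ j → sgn j * M 0 j * Det n (minor 0 j M))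
    row-expansion n M = refl

  skip-< : ∀ {n} j {k} → k < n → skip j k < suc n
  skip-< zero k<n = s≤s k<n
  skip-< (suc j) {zero} k<n = s≤s z≤n
  skip-< (suc j) {suc k} (s≤s k<n) = s≤s (skip-< j k<n)

  Det-cong-< : ∀ n {M N : Matrix} → (∀ i j → i < n → j < n → M i j ≡ N i j) → Det n M ≡ Det n N
  Det-cong-< zero eq = trans (Det-zero _) (sym (Det-zero _))
  Det-cong-< (suc n) {M} {N} eq = begin
    Det (suc n) M ≡⟨ row-expansion n M ⟩
    _             ≡⟨ ∑-cong-< (suc n) (λ j j<n → cong₂ (λ a b → sgn j * a * b) (eq 0 j (s≤s z≤n) j<n)
                       (Det-cong-< n (λ i k i<n k<n → eq (suc i) (skip j k) (s≤s i<n) (skip-< j k<n)))) ⟩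
    _             ≡⟨ row-expansion n N ⟨
    Det (suc n) N ∎

  Det-cong : ∀ n {M N : Matrix} → (∀ i j → M i j ≡ N i j) → Det n M ≡ Det n N
  Det-cong n eq = Det-cong-< n λ i j _ _ → eq i j

  private
    toℕ-punchIn : ∀ {n} (j : Fin (suc n)) k → toℕ (punchIn j k) ≡ skip (toℕ j) (toℕ k)
    toℕ-punchIn zero k = refl
    toℕ-punchIn (suc j) zero = refl
    toℕ-punchIn (suc j) (suc k) = cong suc (toℕ-punchIn j k)

    foldr-tabulate : ∀ n (g : ℕ → ℤ) {h : Fin n → ℤ} → (∀ i → h i ≡ g (toℕ i)) →
      foldr _+_ 0ℤ (tabulate h) ≡ ∑ n g
    foldr-tabulate zero g eq = sym (∑-zero g)
    foldr-tabulate (suc n) g eq =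
      trans (cong₂ _+_ (eq zero) (foldr-tabulate n (g ∘ suc) (eq ∘ suc))) (sym (∑-suc n g))

  det≡Det : ∀ n {M : Fin n → Fin n → ℤ} {N : Matrix} →
    (∀ i j → M i j ≡ N (toℕ i) (toℕ j)) → det n M ≡ Det n N
  det≡Det zero {N = N} eq = sym (Det-zero N)
  det≡Det (suc n) {M} {N} eq = begin
    det (suc n) M
      ≡⟨ cong sumℤ (map-tabulate id entry) ⟩
    sumℤ (tabulate entry)
      ≡⟨ foldr-tabulate (suc n) _ (λ j → cong₂ (λ a b → sgn (toℕ j) * a * b) (eq zero j)
           (det≡Det n (λ i k → trans (eq (suc i) (punchIn j k)) (cong (N (suc (toℕ i))) (toℕ-punchIn j k))))) ⟩
    _ ≡⟨ row-expansion n N ⟨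
    Det (suc n) N ∎
    where
    entry : Fin (suc n) → ℤ
    entry j = sgn (toℕ j) * M zero j * det n (λ i k → M (suc i) (punchIn j k))

  private
    exchange-signs : ∀ s t a b D → (-1ℤ * s * a) * (t * b * D) ≡ (-1ℤ * t * b) * (s * a * D)
    exchange-signs = solve-∀

  -- Every minor except the corner one is expanded along its first column by induction. Both
  -- expansions then delete row 0, column 0 and one further row and column, leaving the same
  -- `minor₂`, so they differ only in the order of a double sum.
  column-expansion : ∀ n M →
    Det (suc n) M ≡ ∑ (suc n) (λ i → sgn i * M i 0 * Det n (minor i 0 M))
  column-expansion zero M = begin
    Det 1 M                     ≡⟨ row-expansion 0 M ⟩
    _                           ≡⟨ ∑-one _ ⟩
    1ℤ * M 0 0 * Det 0 (minor 0 0 M) ≡⟨ ∑-one (λ i → sgn i * M i 0 * Det 0 (minor i 0 M)) ⟨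
    _ ∎
  column-expansion (suc n) M = begin
    Det (2+ n) M ≡⟨ row-expansion (suc n) M ⟩
    _ ≡⟨ ∑-suc (suc n) _ ⟩
    first + ∑ (suc n) (λ j → row j * Det (suc n) (minor 0 (suc j) M))
      ≡⟨ cong (first +_) (∑-cong (suc n) λ j → trans
           (cong (row j *_) (column-expansion n (minor 0 (suc j) M)))
           (∑-distribˡ-* (suc n) (row j) _)) ⟩
    first + ∑ (suc n) (λ j → ∑ (suc n) (λ i → row j * (sgn i * M (suc i) 0 * minor₂ i j)))
      ≡⟨ cong (first +_) (∑-cong (suc n) λ j → ∑-cong (suc n) λ i →
           exchange-signs (sgn j) (sgn i) (M 0 (suc j)) (M (suc i) 0) (minor₂ i j)) ⟩
    first + ∑ (suc n) (λ j → ∑ (suc n) (λ i → column i * (sgn j * M 0 (suc j) * minor₂ i j)))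
      ≡⟨ cong (first +_) (∑-comm (suc n) (suc n) _) ⟩
    first + ∑ (suc n) (λ i → ∑ (suc n) (λ j → column i * (sgn j * M 0 (suc j) * minor₂ i j)))
      ≡⟨ cong (first +_) (∑-cong (suc n) λ i → trans
           (cong (column i *_) (row-expansion n (minor (suc i) 0 M)))
           (∑-distribˡ-* (suc n) (column i) _)) ⟨
    first + ∑ (suc n) (λ i → column i * Det (suc n) (minor (suc i) 0 M))
      ≡⟨ ∑-suc (suc n) _ ⟨
    _ ∎
    where
    first : ℤ
    first = sgn 0 * M 0 0 * Det (suc n) (minor 0 0 M)
    row column : ℕ → ℤ
    row j = sgn (suc j) * M 0 (suc j)
    column i = sgn (suc i) * M (suc i) 0
    minor₂ : ℕ → ℕ → ℤ
    minor₂ i j = Det n (λ r k → M (suc (skip i r)) (suc (skip j k)))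

  Det-transpose : ∀ n M → Det n M ≡ Det n (λ i j → M j i)
  Det-transpose zero M = trans (Det-zero _) (sym (Det-zero _))
  Det-transpose (suc n) M = begin
    Det (suc n) M ≡⟨ row-expansion n M ⟩
    _             ≡⟨ ∑-cong (suc n) (λ j → cong (sgn j * M 0 j *_) (Det-transpose n (minor 0 j M))) ⟩
    _             ≡⟨ column-expansion n (λ i j → M j i) ⟨
    Det (suc n) (λ i j → M j i) ∎

  private
    tails : (ℕ → ℕ → ℤ) → ℕ → ℕ → ℤ
    tails Y i k = Y i (suc k)

    -- In the terms that come from rows of `Y`, the rows `a` and `b` stay on top, one column
    -- shorter; this recursive shape drives the inductions for repeated and for swapped rows.
    first-two : ∀ n (a b : ℕ → ℤ) (Y : Matrix) → Det (2+ n) (a ◂ b ◂ Y) ≡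
      1ℤ * a 0 * Det (suc n) (b ∘ suc ◂ tails Y)
      + (-1ℤ * 1ℤ * b 0 * Det (suc n) (a ∘ suc ◂ tails Y)
      + ∑ n (λ i → sgn (2+ i) * Y i 0 * Det (suc n) (a ∘ suc ◂ b ∘ suc ◂ tails (Y ∘ skip i))))
    first-two n a b Y = begin
      Det (2+ n) M ≡⟨ column-expansion (suc n) M ⟩
      _ ≡⟨ ∑-suc (suc n) _ ⟩
      _ ≡⟨ cong (1ℤ * a 0 * Det (suc n) (minor 0 0 M) +_) (∑-suc n _) ⟩
      1ℤ * a 0 * Det (suc n) (minor 0 0 M) + (-1ℤ * 1ℤ * b 0 * Det (suc n) (minor 1 0 M)
        + ∑ n (λ i → sgn (2+ i) * Y i 0 * Det (suc n) (minor (2+ i) 0 M)))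
        ≡⟨ cong₂ (λ x y → 1ℤ * a 0 * x + y)
             (Det-cong (suc n) {minor 0 0 M} {b ∘ suc ◂ tails Y} λ { zero k → refl ; (suc i) k → refl })
             (cong₂ (λ x y → -1ℤ * 1ℤ * b 0 * x + y)
               (Det-cong (suc n) {minor 1 0 M} {a ∘ suc ◂ tails Y} λ { zero k → refl ; (suc i) k → refl })
               (∑-cong n λ i → cong (sgn (2+ i) * Y i 0 *_)
                 (Det-cong (suc n) {minor (2+ i) 0 M} {a ∘ suc ◂ b ∘ suc ◂ tails (Y ∘ skip i)}
                   λ { zero k → refl ; (suc zero) k → refl ; (2+ r) k → refl }))) ⟩
      _ ∎
      where
      M : Matrix
      M = a ◂ b ◂ Y

    two-terms : ∀ a D → 1ℤ * a * D + (-1ℤ * 1ℤ * a * D + 0ℤ) ≡ 0ℤ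
    two-terms = solve-∀
    swap-two-terms : ∀ a b D E S →
      1ℤ * a * D + (-1ℤ * 1ℤ * b * E + - S) ≡ - (1ℤ * b * E + (-1ℤ * 1ℤ * a * D + S))
    swap-two-terms = solve-∀
    linear-term : ∀ s x c y D → s * (x + c * y) * D ≡ s * x * D + c * (s * y * D)
    linear-term = solve-∀
    drop-zero : ∀ x c → - (x + c * 0ℤ) ≡ - x
    drop-zero = solve-∀

  Det-repeated-row : ∀ n a Y → Det (2+ n) (a ◂ a ◂ Y) ≡ 0ℤ
  Det-repeated-row n a Y = begin
    Det (2+ n) (a ◂ a ◂ Y) ≡⟨ first-two n a a Y ⟩
    _ ≡⟨ cong (λ S → 1ℤ * a 0 * D + (-1ℤ * 1ℤ * a 0 * D + S)) (rest n a Y) ⟩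
    1ℤ * a 0 * D + (-1ℤ * 1ℤ * a 0 * D + 0ℤ) ≡⟨ two-terms (a 0) D ⟩
    0ℤ ∎
    where
    D : ℤ
    D = Det (suc n) (a ∘ suc ◂ tails Y)
    rest : ∀ n a Y → ∑ n (λ i → sgn (2+ i) * Y i 0 * Det (suc n) (a ∘ suc ◂ a ∘ suc ◂ tails (Y ∘ skip i))) ≡ 0ℤ
    rest zero a Y = ∑-zero _
    rest (suc n) a Y = ∑-vanish (suc n) λ i →
      trans (cong (sgn (2+ i) * Y i 0 *_) (Det-repeated-row n (a ∘ suc) (tails (Y ∘ skip i)))) (*-zeroʳ (sgn (2+ i) * Y i 0))

  Det-swap : ∀ n a b Y → Det (2+ n) (a ◂ b ◂ Y) ≡ - Det (2+ n) (b ◂ a ◂ Y)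
  Det-swap n a b Y = begin
    Det (2+ n) (a ◂ b ◂ Y) ≡⟨ first-two n a b Y ⟩
    _ ≡⟨ cong (λ S → 1ℤ * a 0 * D b + (-1ℤ * 1ℤ * b 0 * D a + S)) (rest n a b Y) ⟩
    1ℤ * a 0 * D b + (-1ℤ * 1ℤ * b 0 * D a + - _) ≡⟨ swap-two-terms (a 0) (b 0) (D b) (D a) _ ⟩
    - (1ℤ * b 0 * D a + (-1ℤ * 1ℤ * a 0 * D b + _)) ≡⟨ cong -_ (first-two n b a Y) ⟨
    - Det (2+ n) (b ◂ a ◂ Y) ∎
    where
    D : (ℕ → ℤ) → ℤ
    D a = Det (suc n) (a ∘ suc ◂ tails Y)
    R : ∀ n (a b : ℕ → ℤ) (Y : ℕ → ℕ → ℤ) → ℕ → ℤ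
    R n a b Y i = sgn (2+ i) * Y i 0 * Det (suc n) (a ∘ suc ◂ b ∘ suc ◂ tails (Y ∘ skip i))
    rest : ∀ n a b Y → ∑ n (R n a b Y) ≡ - ∑ n (R n b a Y)
    rest zero a b Y = trans (∑-zero _) (cong -_ (sym (∑-zero (R zero b a Y))))
    rest (suc n) a b Y = trans
      (∑-cong (suc n) λ i → trans
        (cong (sgn (2+ i) * Y i 0 *_) (Det-swap n (a ∘ suc) (b ∘ suc) (tails (Y ∘ skip i))))
        (sym (neg-distribʳ-* (sgn (2+ i) * Y i 0) _)))
      (∑-neg (suc n) (R (suc n) b a Y))

  Det-linear : ∀ n (a b : ℕ → ℤ) (c : ℤ) (Y : Matrix) →
    Det (suc n) ((λ j → a j + c * b j) ◂ Y) ≡ Det (suc n) (a ◂ Y) + c * Det (suc n) (b ◂ Y)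
  Det-linear n a b c Y = begin
    _ ≡⟨ row-expansion n _ ⟩
    ∑ (suc n) (λ j → sgn j * (a j + c * b j) * D j)
      ≡⟨ ∑-cong (suc n) (λ j → linear-term (sgn j) (a j) c (b j) (D j)) ⟩
    _ ≡⟨ ∑-distrib-+ (suc n) _ _ ⟩
    ∑ (suc n) (λ j → sgn j * a j * D j) + ∑ (suc n) (λ j → c * (sgn j * b j * D j))
      ≡⟨ cong₂ _+_ (row-expansion n (a ◂ Y))
          (trans (cong (c *_) (row-expansion n (b ◂ Y))) (∑-distribˡ-* (suc n) c _)) ⟨
    _ ∎
    where
    D : ℕ → ℤ
    D j = Det n (λ i k → Y i (skip j k))

  Det-add-first-to-second : ∀ n (a b : ℕ → ℤ) (c : ℤ) (Y : Matrix) →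
    Det (2+ n) (a ◂ (λ j → b j + c * a j) ◂ Y) ≡ Det (2+ n) (a ◂ b ◂ Y)
  Det-add-first-to-second n a b c Y = begin
    Det (2+ n) (a ◂ (λ j → b j + c * a j) ◂ Y)
      ≡⟨ Det-swap n a (λ j → b j + c * a j) Y ⟩
    - Det (2+ n) ((λ j → b j + c * a j) ◂ a ◂ Y)
      ≡⟨ cong -_ (Det-linear (suc n) b a c (a ◂ Y)) ⟩
    - (Det (2+ n) (b ◂ a ◂ Y) + c * Det (2+ n) (a ◂ a ◂ Y))
      ≡⟨ cong (λ x → - (Det (2+ n) (b ◂ a ◂ Y) + c * x)) (Det-repeated-row n a Y) ⟩
    - (Det (2+ n) (b ◂ a ◂ Y) + c * 0ℤ)
      ≡⟨ drop-zero (Det (2+ n) (b ◂ a ◂ Y)) c ⟩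
    - Det (2+ n) (b ◂ a ◂ Y)
      ≡⟨ Det-swap n a b Y ⟨
    Det (2+ n) (a ◂ b ◂ Y) ∎

  Det-◂-cong : ∀ n (a : ℕ → ℤ) (Y Z : Matrix) →
    (∀ j → Det n (λ i k → Y i (skip j k)) ≡ Det n (λ i k → Z i (skip j k))) →
    Det (suc n) (a ◂ Y) ≡ Det (suc n) (a ◂ Z)
  Det-◂-cong n a Y Z eq = begin
    Det (suc n) (a ◂ Y) ≡⟨ row-expansion n (a ◂ Y) ⟩
    _ ≡⟨ ∑-cong (suc n) (λ j → cong (sgn j * a j *_) (eq j)) ⟩
    _ ≡⟨ row-expansion n (a ◂ Z) ⟨
    Det (suc n) (a ◂ Z) ∎

  -- Only the second row can be treated directly. Once it is clean, `a` is swapped below it;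
  -- expanding along the new top row leaves smaller determinants that begin with `a`, to which the
  -- induction applies.
  Det-add-first : ∀ n (a c : ℕ → ℤ) (Y : Matrix) →
    Det (suc n) (a ◂ λ i j → Y i j + c i * a j) ≡ Det (suc n) (a ◂ Y)
  Det-add-first zero a c Y = Det-◂-cong 0 a _ Y λ j → trans (Det-zero _) (sym (Det-zero _))
  Det-add-first (suc n) a c Y = begin
    Det (2+ n) (a ◂ Y′)
      ≡⟨ Det-cong (2+ n) {a ◂ Y′} {a ◂ (λ j → Y 0 j + c 0 * a j) ◂ Y′ ∘ suc}
           (λ { zero j → refl ; (suc zero) j → refl ; (2+ i) j → refl }) ⟩
    Det (2+ n) (a ◂ (λ j → Y 0 j + c 0 * a j) ◂ Y′ ∘ suc)
      ≡⟨ Det-add-first-to-second n a (Y 0) (c 0) (Y′ ∘ suc) ⟩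
    Det (2+ n) (a ◂ Y 0 ◂ Y′ ∘ suc)
      ≡⟨ Det-swap n a (Y 0) (Y′ ∘ suc) ⟩
    - Det (2+ n) (Y 0 ◂ a ◂ Y′ ∘ suc)
      ≡⟨ cong -_ (Det-◂-cong (suc n) (Y 0) (a ◂ Y′ ∘ suc) (a ◂ Y ∘ suc) λ j → begin
           Det (suc n) (λ i k → (a ◂ Y′ ∘ suc) i (skip j k))
             ≡⟨ Det-cong (suc n) (λ { zero k → refl ; (suc i) k → refl }) ⟩
           Det (suc n) (a ∘ skip j ◂ λ i k → Y (suc i) (skip j k) + c (suc i) * a (skip j k))
             ≡⟨ Det-add-first n (a ∘ skip j) (c ∘ suc) (λ i k → Y (suc i) (skip j k)) ⟩
           Det (suc n) (a ∘ skip j ◂ λ i k → Y (suc i) (skip j k))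
             ≡⟨ Det-cong (suc n) (λ { zero k → refl ; (suc i) k → refl }) ⟩
           Det (suc n) (λ i k → (a ◂ Y ∘ suc) i (skip j k)) ∎) ⟩
    - Det (2+ n) (Y 0 ◂ a ◂ Y ∘ suc)
      ≡⟨ Det-swap n a (Y 0) (Y ∘ suc) ⟨
    Det (2+ n) (a ◂ Y 0 ◂ Y ∘ suc)
      ≡⟨ Det-cong (2+ n) {a ◂ Y 0 ◂ Y ∘ suc} {a ◂ Y}
           (λ { zero j → refl ; (suc zero) j → refl ; (2+ i) j → refl }) ⟩
    Det (2+ n) (a ◂ Y) ∎
    where
    Y′ : Matrix
    Y′ i j = Y i j + c i * a j

  UnitLower : Matrix → Set
  UnitLower L = (∀ i → L i i ≡ 1ℤ) × (∀ i j → i < j → L i j ≡ 0ℤ)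

  -- Row 0 of the product is `X 0`; row operations with it remove column 0 of `L` from the other
  -- rows. Expanding along `X 0` leaves products with the lower right part of `L`, which is again
  -- unitriangular.
  Det-unitLower-* : ∀ n (L X : Matrix) → UnitLower L →
    Det n (λ i j → ∑ n (λ k → L i k * X k j)) ≡ Det n X
  Det-unitLower-* zero L X _ = trans (Det-zero _) (sym (Det-zero _))
  Det-unitLower-* (suc n) L X (diag , upper) = begin
    Det (suc n) (λ i j → ∑ (suc n) (λ k → L i k * X k j))
      ≡⟨ Det-cong (suc n) {N = X 0 ◂ λ i j → P i j + L (suc i) 0 * X 0 j}
           (λ { zero j → first-row j ; (suc i) j → trans (∑-suc n _) (+-comm _ (P i j)) }) ⟩
    Det (suc n) (X 0 ◂ λ i j → P i j + L (suc i) 0 * X 0 j)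
      ≡⟨ Det-add-first n (X 0) (λ i → L (suc i) 0) P ⟩
    Det (suc n) (X 0 ◂ P)
      ≡⟨ Det-◂-cong n (X 0) P (X ∘ suc) (λ j →
           Det-unitLower-* n (λ i k → L (suc i) (suc k)) (λ k l → X (suc k) (skip j l))
             ((λ i → diag (suc i)) , (λ i k i<k → upper (suc i) (suc k) (s≤s i<k)))) ⟩
    Det (suc n) (X 0 ◂ X ∘ suc)
      ≡⟨ Det-cong (suc n) {X 0 ◂ X ∘ suc} {X} (λ { zero j → refl ; (suc i) j → refl }) ⟩
    Det (suc n) X ∎
    where
    P : Matrix
    P i j = ∑ n (λ k → L (suc i) (suc k) * X (suc k) j)
    first-row : ∀ j → ∑ (suc n) (λ k → L 0 k * X k j) ≡ X 0 j
    first-row j = begin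
      ∑ (suc n) (λ k → L 0 k * X k j) ≡⟨ ∑-suc n _ ⟩
      L 0 0 * X 0 j + ∑ n (λ k → L 0 (suc k) * X (suc k) j)
        ≡⟨ cong₂ _+_ (trans (cong (_* X 0 j) (diag 0)) (*-identityˡ (X 0 j)))
             (∑-vanish n λ k → cong (_* X (suc k) j) (upper 0 (suc k) (s≤s z≤n))) ⟩
      X 0 j + 0ℤ ≡⟨ +-identityʳ (X 0 j) ⟩
      X 0 j ∎

  Det-congruence : ∀ n L S → UnitLower L →
    Det n (λ i j → ∑ n (λ k → L i k * ∑ n (λ l → L j l * S k l))) ≡ Det n S
  Det-congruence n L S unit = begin
    Det n (λ i j → ∑ n (λ k → L i k * ∑ n (λ l → L j l * S k l)))
      ≡⟨ Det-unitLower-* n L (λ k j → ∑ n (λ l → L j l * S k l)) unit ⟩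
    Det n (λ k j → ∑ n (λ l → L j l * S k l))
      ≡⟨ Det-transpose n _ ⟩
    Det n (λ j k → ∑ n (λ l → L j l * S k l))
      ≡⟨ Det-unitLower-* n L (λ l k → S k l) unit ⟩
    Det n (λ l k → S k l)
      ≡⟨ Det-transpose n _ ⟩
    Det n S ∎

-- Tridiagonal borders, continuants and their bilinear forms.

module BorderedMatrices where

  open FiniteSums
  open Determinants
  open import Data.Nat using (ℕ; zero; suc; 2+)
  import Data.Nat as ℕ
  open import Data.Integer using (ℤ; _+_; _*_; -_; _-_; 0ℤ; 1ℤ; -1ℤ)
  open import Data.Integer.Properties
  open import Data.Integer.Tactic.RingSolver using (solve-∀)
  open import Function using (_∘_)
  open import Relation.Binary.PropositionalEquality
  open ≡-Reasoning

  first-only : ℤ → ℕ → ℤ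
  first-only t zero = t
  first-only t (suc i) = 0ℤ

  edge : ℤ → ℤ → Matrix → Matrix
  edge s t S zero zero = s
  edge s t S zero (suc j) = first-only t j
  edge s t S (suc i) zero = first-only t i
  edge s t S (suc i) (suc j) = S i j

  border : (σ τ : ℕ → ℤ) → ℕ → Matrix → Matrix
  border σ τ zero T = T
  border σ τ (suc p) T = edge (σ 0) (τ 0) (border (σ ∘ suc) (τ ∘ suc) p T)

  continuant : (σ τ : ℕ → ℤ) → ℕ → ℤ
  continuant σ τ zero = 1ℤ
  continuant σ τ (suc zero) = σ 0
  continuant σ τ (2+ p) =
    σ 0 * continuant (σ ∘ suc) (τ ∘ suc) (suc p) - τ 0 * τ 0 * continuant (σ ∘ suc ∘ suc) (τ ∘ suc ∘ suc) p

  private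
    zero-middle : ∀ s D → s * 0ℤ * D ≡ 0ℤ
    zero-middle = solve-∀
    zero-right : ∀ x y → x * (y * 0ℤ) ≡ 0ℤ
    zero-right = solve-∀
    collect-minors : ∀ s t D E →
      1ℤ * s * D + (-1ℤ * 1ℤ * t * (1ℤ * t * E + 0ℤ) + 0ℤ) ≡ s * D - t * t * E
    collect-minors = solve-∀

  Det-edge : ∀ n s t S →
    Det (2+ n) (edge s t S) ≡ s * Det (suc n) S - t * t * Det n (λ i j → S (suc i) (suc j))
  Det-edge n s t S = begin
    Det (2+ n) E
      ≡⟨ trans (row-expansion (suc n) E) (trans (∑-suc (suc n) _) (cong (1ℤ * s * Det (suc n) S +_) (∑-suc n _))) ⟩
    1ℤ * s * Det (suc n) S + (-1ℤ * 1ℤ * t * Det (suc n) (minor 0 1 E)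
      + ∑ n (λ j → sgn (2+ j) * 0ℤ * Det (suc n) (minor 0 (2+ j) E)))
      ≡⟨ cong₂ (λ x y → 1ℤ * s * Det (suc n) S + (-1ℤ * 1ℤ * t * x + y)) second
           (∑-vanish n λ j → zero-middle (sgn (2+ j)) _) ⟩
    1ℤ * s * Det (suc n) S + (-1ℤ * 1ℤ * t * (1ℤ * t * Det n S₁ + 0ℤ) + 0ℤ)
      ≡⟨ collect-minors s t (Det (suc n) S) (Det n S₁) ⟩
    s * Det (suc n) S - t * t * Det n S₁ ∎
    where
    E S₁ : Matrix
    E = edge s t S
    S₁ i j = S (suc i) (suc j)
    second : Det (suc n) (minor 0 1 E) ≡ 1ℤ * t * Det n S₁ + 0ℤ
    second = begin
      Det (suc n) (minor 0 1 E) ≡⟨ column-expansion n (minor 0 1 E) ⟩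
      _ ≡⟨ ∑-suc n _ ⟩
      1ℤ * t * Det n S₁ + ∑ n (λ i → sgn (suc i) * 0ℤ * Det n (minor (suc i) 0 (minor 0 1 E)))
        ≡⟨ cong (1ℤ * t * Det n S₁ +_) (∑-vanish n λ i → zero-middle (sgn (suc i)) _) ⟩
      1ℤ * t * Det n S₁ + 0ℤ ∎

  private
    one-border : ∀ s D E → s * D - 0ℤ * 0ℤ * E ≡ s * D
    one-border = solve-∀
    two-borders : ∀ s t s′ D → s * (s′ * D) - t * t * D ≡ (s * s′ - t * t * 1ℤ) * D
    two-borders = solve-∀
    more-borders : ∀ s t K L D → s * (K * D) - t * t * (L * D) ≡ (s * K - t * t * L) * D
    more-borders = solve-∀

  -- The hypothesis removes the only coupling between the tridiagonal block and `T`. The part taken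
  -- from `T` has size at least 1, because `Det-edge` wants a row below the edge; this is why Hankel
  -- orders start at 1.
  Det-border : ∀ p n σ τ T → τ p ≡ 0ℤ →
    Det (2+ (p ℕ.+ n)) (border σ τ (suc p) T) ≡ continuant σ τ (suc p) * Det (suc n) T
  Det-border zero n σ τ T τ≡0 = begin
    _ ≡⟨ Det-edge n (σ 0) (τ 0) T ⟩
    σ 0 * Det (suc n) T - τ 0 * τ 0 * Det n (λ i j → T (suc i) (suc j))
      ≡⟨ cong (λ t → σ 0 * Det (suc n) T - t * t * Det n (λ i j → T (suc i) (suc j))) τ≡0 ⟩
    _ ≡⟨ one-border (σ 0) (Det (suc n) T) (Det n (λ i j → T (suc i) (suc j))) ⟩
    σ 0 * Det (suc n) T ∎
  Det-border (suc zero) n σ τ T τ≡0 = begin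
    _ ≡⟨ Det-edge (suc n) (σ 0) (τ 0) (border (σ ∘ suc) (τ ∘ suc) 1 T) ⟩
    σ 0 * Det (2+ n) (border (σ ∘ suc) (τ ∘ suc) 1 T) - τ 0 * τ 0 * Det (suc n) T
      ≡⟨ cong (λ x → σ 0 * x - τ 0 * τ 0 * Det (suc n) T) (Det-border zero n (σ ∘ suc) (τ ∘ suc) T τ≡0) ⟩
    σ 0 * (σ 1 * Det (suc n) T) - τ 0 * τ 0 * Det (suc n) T
      ≡⟨ two-borders (σ 0) (τ 0) (σ 1) (Det (suc n) T) ⟩
    (σ 0 * σ 1 - τ 0 * τ 0 * 1ℤ) * Det (suc n) T ∎
  Det-border (2+ p) n σ τ T τ≡0 = begin
    _ ≡⟨ Det-edge (2+ (p ℕ.+ n)) (σ 0) (τ 0) (border (σ ∘ suc) (τ ∘ suc) (2+ p) T) ⟩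
    _ ≡⟨ cong₂ (λ x y → σ 0 * x - τ 0 * τ 0 * y)
           (Det-border (suc p) n (σ ∘ suc) (τ ∘ suc) T τ≡0)
           (Det-border p n (σ ∘ suc ∘ suc) (τ ∘ suc ∘ suc) T τ≡0) ⟩
    _ ≡⟨ more-borders (σ 0) (τ 0) (continuant (σ ∘ suc) (τ ∘ suc) (2+ p))
           (continuant (σ ∘ suc ∘ suc) (τ ∘ suc ∘ suc) (suc p)) (Det (suc n) T) ⟩
    _ ∎

  private
    continuant-base : ∀ a b t → a * b - t * t * 1ℤ ≡ b * a - t * t * 1ℤ
    continuant-base = solve-∀
    continuant-base′ : ∀ a b c t u → a * (b * c - u * u * 1ℤ) - t * t * c ≡ c * (a * b - t * t * 1ℤ) - u * u * a
    continuant-base′ = solve-∀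
    continuant-step : ∀ s t x y K L K′ L′ →
      s * (x * K - y * y * L) - t * t * (x * K′ - y * y * L′) ≡ x * (s * K - t * t * K′) - y * y * (s * L - t * t * L′)
    continuant-step = solve-∀

  -- Borders are peeled off at the front, while `leading` grows at the far end; Euler's symmetry of
  -- continuants reconciles the two.
  continuant-last : ∀ p σ τ →
    continuant σ τ (2+ p) ≡ σ (suc p) * continuant σ τ (suc p) - τ p * τ p * continuant σ τ p
  continuant-last zero σ τ = continuant-base (σ 0) (σ 1) (τ 0)
  continuant-last (suc zero) σ τ = continuant-base′ (σ 0) (σ 1) (σ 2) (τ 0) (τ 1)
  continuant-last (2+ p) σ τ = begin
    _ ≡⟨ cong₂ (λ x y → σ 0 * x - τ 0 * τ 0 * y)
           (continuant-last (suc p) (σ ∘ suc) (τ ∘ suc)) (continuant-last p (σ ∘ suc ∘ suc) (τ ∘ suc ∘ suc)) ⟩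
    _ ≡⟨ continuant-step (σ 0) (τ 0) (σ (suc (2+ p))) (τ (2+ p))
           (continuant (σ ∘ suc) (τ ∘ suc) (2+ p)) (continuant (σ ∘ suc) (τ ∘ suc) (suc p))
           (continuant (σ ∘ suc ∘ suc) (τ ∘ suc ∘ suc) (suc p)) (continuant (σ ∘ suc ∘ suc) (τ ∘ suc ∘ suc) p) ⟩
    _ ∎

  bilinear : ℕ → Matrix → (X Y : ℕ → ℤ) → ℤ
  bilinear n S X Y = ∑ n (λ k → X k * ∑ n (λ l → Y l * S k l))

  private
    collect-edge : ∀ s t x₀ y₀ x₁ y₁ B →
      x₀ * (y₀ * s + (y₁ * t + 0ℤ)) + (x₁ * (y₀ * t) + 0ℤ + B) ≡ s * x₀ * y₀ + t * (x₀ * y₁ + x₁ * y₀) + B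
    collect-edge = solve-∀

  bilinear-edge : ∀ n s t S X Y → bilinear (2+ n) (edge s t S) X Y ≡
    s * X 0 * Y 0 + t * (X 0 * Y 1 + X 1 * Y 0) + bilinear (suc n) S (X ∘ suc) (Y ∘ suc)
  bilinear-edge n s t S X Y = begin
    bilinear (2+ n) (edge s t S) X Y
      ≡⟨ ∑-suc (suc n) _ ⟩
    X 0 * ∑ (2+ n) (λ l → Y l * edge s t S 0 l) + ∑ (suc n) (λ k → X (suc k) * ∑ (2+ n) (λ l → Y l * edge s t S (suc k) l))
      ≡⟨ cong₂ (λ x y → X 0 * x + y) first-row other-rows ⟩
    X 0 * (Y 0 * s + (Y 1 * t + 0ℤ)) + (X 1 * (Y 0 * t) + 0ℤ + bilinear (suc n) S (X ∘ suc) (Y ∘ suc))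
      ≡⟨ collect-edge s t (X 0) (Y 0) (X 1) (Y 1) _ ⟩
    _ ∎
    where
    first-row : ∑ (2+ n) (λ l → Y l * edge s t S 0 l) ≡ Y 0 * s + (Y 1 * t + 0ℤ)
    first-row = begin
      _ ≡⟨ ∑-suc (suc n) _ ⟩
      Y 0 * s + ∑ (suc n) (λ l → Y (suc l) * first-only t l) ≡⟨ cong (Y 0 * s +_) (∑-suc n _) ⟩
      Y 0 * s + (Y 1 * t + ∑ n (λ l → Y (2+ l) * 0ℤ))
        ≡⟨ cong (λ x → Y 0 * s + (Y 1 * t + x)) (∑-vanish n λ l → *-zeroʳ (Y (2+ l))) ⟩
      Y 0 * s + (Y 1 * t + 0ℤ) ∎
    other-rows : ∑ (suc n) (λ k → X (suc k) * ∑ (2+ n) (λ l → Y l * edge s t S (suc k) l)) ≡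
      X 1 * (Y 0 * t) + 0ℤ + bilinear (suc n) S (X ∘ suc) (Y ∘ suc)
    other-rows = begin
      _ ≡⟨ ∑-cong (suc n) (λ k → trans (cong (X (suc k) *_) (∑-suc (suc n) _))
             (*-distribˡ-+ (X (suc k)) (Y 0 * first-only t k) (∑ (suc n) (λ l → Y (suc l) * S k l)))) ⟩
      _ ≡⟨ ∑-distrib-+ (suc n) _ _ ⟩
      ∑ (suc n) (λ k → X (suc k) * (Y 0 * first-only t k)) + bilinear (suc n) S (X ∘ suc) (Y ∘ suc)
        ≡⟨ cong (_+ bilinear (suc n) S (X ∘ suc) (Y ∘ suc)) (trans (∑-suc n _)
             (cong (X 1 * (Y 0 * t) +_) (∑-vanish n λ k → zero-right (X (2+ k)) (Y 0)))) ⟩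
      _ ∎

  bilinear-border : ∀ p n σ τ T X Y → bilinear (suc (p ℕ.+ n)) (border σ τ p T) X Y ≡
    ∑ p (λ k → σ k * X k * Y k + τ k * (X k * Y (suc k) + X (suc k) * Y k))
      + bilinear (suc n) T (λ k → X (p ℕ.+ k)) (λ k → Y (p ℕ.+ k))
  bilinear-border zero n σ τ T X Y =
    trans (sym (+-identityˡ (bilinear (suc n) T X Y))) (cong (_+ bilinear (suc n) T X Y) (sym (∑-zero _)))
  bilinear-border (suc p) n σ τ T X Y = begin
    _ ≡⟨ bilinear-edge (p ℕ.+ n) (σ 0) (τ 0) _ X Y ⟩
    q 0 + bilinear (suc (p ℕ.+ n)) (border (σ ∘ suc) (τ ∘ suc) p T) (X ∘ suc) (Y ∘ suc)
      ≡⟨ cong (q 0 +_) (bilinear-border p n (σ ∘ suc) (τ ∘ suc) T (X ∘ suc) (Y ∘ suc)) ⟩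
    q 0 + (∑ p (q ∘ suc) + rest) ≡⟨ +-assoc (q 0) (∑ p (q ∘ suc)) rest ⟨
    q 0 + ∑ p (q ∘ suc) + rest ≡⟨ cong (_+ rest) (∑-suc p q) ⟨
    ∑ (suc p) q + rest ∎
    where
    q : ℕ → ℤ
    q k = σ k * X k * Y k + τ k * (X k * Y (suc k) + X (suc k) * Y k)
    rest : ℤ
    rest = bilinear (suc n) T (λ k → X (suc p ℕ.+ k)) (λ k → Y (suc p ℕ.+ k))

-- Half-path series and the decomposition of the Hankel matrix by levels.

module LevelSeries where

  open FiniteSums
  open BorderedMatrices using (bilinear)
  open import Data.Nat using (ℕ; zero; suc; 2+; _<_; _≤_; s≤s)
  import Data.Nat as ℕ
  import Data.Nat.Properties as ℕ
  open import Data.Integer using (ℤ; _+_; _*_; -_; _-_; 0ℤ; 1ℤ)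
  open import Data.Integer.Properties
  open import Data.Integer.Tactic.RingSolver using (solve-∀)
  open import Function using (_∘_)
  open import Relation.Binary.PropositionalEquality
  open ≡-Reasoning

  double : ℕ → ℕ
  double zero = zero
  double (suc k) = 2+ (double k)

  double-+ : ∀ m n → double (m ℕ.+ n) ≡ double m ℕ.+ double n
  double-+ zero n = refl
  double-+ (suc m) n = cong 2+ (double-+ m n)

  -- Coefficients of x^k P(x).
  shift : ℕ → (ℕ → ℤ) → ℕ → ℤ
  shift zero P i = P i
  shift (suc k) P zero = 0ℤ
  shift (suc k) P (suc i) = shift k P i

  shift-< : ∀ k P i → i < k → shift k P i ≡ 0ℤ
  shift-< (suc k) P zero _ = refl
  shift-< (suc k) P (suc i) (s≤s i<k) = shift-< k P i i<k

  shift-diagonal : ∀ k P → shift k P k ≡ P 0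
  shift-diagonal zero P = refl
  shift-diagonal (suc k) P = shift-diagonal k P

  shift-cong : ∀ k {P Q} → (∀ i → P i ≡ Q i) → ∀ i → shift k P i ≡ shift k Q i
  shift-cong zero eq i = eq i
  shift-cong (suc k) eq zero = refl
  shift-cong (suc k) eq (suc i) = shift-cong k eq i

  shift-zero-cong : ∀ k P Q → P 0 ≡ Q 0 → shift k P 0 ≡ shift k Q 0
  shift-zero-cong zero P Q eq = eq
  shift-zero-cong (suc k) P Q eq = refl

  private
    no-correction : ∀ q c → q ≡ q + 0ℤ - c * 0ℤ
    no-correction = solve-∀
    rotate : ∀ r c p q → r - c * p + q ≡ q + r - c * p
    rotate = solve-∀

  -- As series, P = Q + xR - cxP, multiplied by x^k. The equality of constant terms settles the
  -- coefficient of x^k, to which the terms with a factor x do not contribute.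
  shift-recurrence : ∀ k (P Q R : ℕ → ℤ) (c : ℤ) → P 0 ≡ Q 0 → (∀ n → P (suc n) ≡ R n - c * P n + Q (suc n)) →
    ∀ i → shift k P (suc i) ≡ shift k Q (suc i) + shift k R i - c * shift k P i
  shift-recurrence zero P Q R c P0≡Q0 rec i = trans (rec i) (rotate (R i) c (P i) (Q (suc i)))
  shift-recurrence (suc k) P Q R c P0≡Q0 rec zero =
    trans (shift-zero-cong k P Q P0≡Q0) (no-correction (shift k Q 0) c)
  shift-recurrence (suc k) P Q R c P0≡Q0 rec (suc i) = shift-recurrence k P Q R c P0≡Q0 rec i

  convolution : (P Q : ℕ → ℤ) → ℕ → ℤ
  convolution P Q zero = P 0 * Q 0
  convolution P Q (suc n) = P (suc n) * Q 0 + convolution P (Q ∘ suc) n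

  private
    distribute : ∀ p r c a q → p * (r - c * a + q) ≡ p * r - c * (p * a) + p * q
    distribute = solve-∀
    distribute-more : ∀ p r c a q R A Q →
      p * (r - c * a + q) + (R - c * A + Q) ≡ p * r + R - c * (p * a + A) + (p * q + Q)
    distribute-more = solve-∀

  convolution-linear : ∀ (P : ℕ → ℤ) {Q : ℕ → ℤ} (R : ℕ → ℤ) (c : ℤ) (S T : ℕ → ℤ) → (∀ n → Q n ≡ R n - c * S n + T n) → ∀ n →
    convolution P Q n ≡ convolution P R n - c * convolution P S n + convolution P T n
  convolution-linear P R c S T eq zero =
    trans (cong (P 0 *_) (eq 0)) (distribute (P 0) (R 0) c (S 0) (T 0))
  convolution-linear P R c S T eq (suc n) =
    trans (cong₂ (λ x y → P (suc n) * x + y) (eq 0) (convolution-linear P (R ∘ suc) c (S ∘ suc) (T ∘ suc) (eq ∘ suc) n))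
      (distribute-more (P (suc n)) (R 0) c (S 0) (T 0) _ _ _)

  -- This is x^(p+k) PQ = (x^p P)(x^k Q); the sum may stop at `n` because x^(p+a) P has no
  -- coefficient at `i` once `a ≥ n`.
  convolution-shift : ∀ p k n P Q i → i < p ℕ.+ n →
    shift (p ℕ.+ k) (convolution P Q) i ≡ ∑ n (λ a → shift (p ℕ.+ a) P i * shift k Q a)
  convolution-shift (suc p) k n P Q zero _ = sym (∑-vanish n λ a → refl)
  convolution-shift (suc p) k n P Q (suc i) (s≤s i<p+n) = convolution-shift p k n P Q i i<p+n
  convolution-shift zero zero (suc n) P Q zero _ =
    sym (trans (∑-suc n _) (trans (cong (P 0 * Q 0 +_) (∑-vanish n λ a → refl)) (+-identityʳ (P 0 * Q 0))))
  convolution-shift zero zero (suc n) P Q (suc i) (s≤s i<n) = begin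
    P (suc i) * Q 0 + convolution P (Q ∘ suc) i
      ≡⟨ cong (P (suc i) * Q 0 +_) (convolution-shift zero zero n P (Q ∘ suc) i i<n) ⟩
    P (suc i) * Q 0 + ∑ n (λ a → shift a P i * Q (suc a)) ≡⟨ ∑-suc n _ ⟨
    ∑ (suc n) (λ a → shift a P (suc i) * Q a) ∎
  convolution-shift zero (suc k) (suc n) P Q zero _ =
    sym (trans (∑-suc n _) (cong₂ _+_ (*-zeroʳ (P 0)) (∑-vanish n λ a → refl)))
  convolution-shift zero (suc k) (suc n) P Q (suc i) (s≤s i<n) = begin
    shift k (convolution P Q) i
      ≡⟨ convolution-shift zero k n P Q i i<n ⟩
    ∑ n (λ a → shift a P i * shift k Q a)
      ≡⟨ +-identityˡ (∑ n (λ a → shift a P i * shift k Q a)) ⟨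
    0ℤ + ∑ n (λ a → shift a P i * shift k Q a)
      ≡⟨ cong (_+ ∑ n (λ a → shift a P i * shift k Q a)) (*-zeroʳ (P (suc i))) ⟨
    P (suc i) * 0ℤ + ∑ n (λ a → shift a P i * shift k Q a)
      ≡⟨ ∑-suc n _ ⟨
    ∑ (suc n) (λ a → shift a P (suc i) * shift (suc k) Q a) ∎

  private
    split-form : ∀ x u V c p Q → x * (u * V - c * p * Q) ≡ V * (x * u) + (- (c * Q)) * (x * p)
    split-form = solve-∀
    split-form′ : ∀ y u v c p q → y * (u * v - c * p * q) ≡ u * (y * v) + (- (c * p)) * (y * q)
    split-form′ = solve-∀
    join-form : ∀ u V c p Q → u * V + (- (c * p)) * Q ≡ u * V - c * p * Q
    join-form = solve-∀
    join-form′ : ∀ U V c P Q → V * U + (- (c * Q)) * P ≡ U * V - c * P * Q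
    join-form′ = solve-∀

  bilinear-∑ : ∀ n N (F : ℕ → ℕ → ℕ → ℤ) X Y →
    bilinear n (λ a b → ∑ N (λ k → F k a b)) X Y ≡ ∑ N (λ k → bilinear n (F k) X Y)
  bilinear-∑ n N F X Y = begin
    ∑ n (λ a → X a * ∑ n (λ b → Y b * ∑ N (λ k → F k a b)))
      ≡⟨ ∑-cong n (λ a → cong (X a *_) (∑-cong n λ b → ∑-distribˡ-* N (Y b) _)) ⟩
    ∑ n (λ a → X a * ∑ n (λ b → ∑ N (λ k → Y b * F k a b)))
      ≡⟨ ∑-cong n (λ a → cong (X a *_) (∑-comm n N _)) ⟩
    ∑ n (λ a → X a * ∑ N (λ k → ∑ n (λ b → Y b * F k a b)))
      ≡⟨ ∑-cong n (λ a → ∑-distribˡ-* N (X a) _) ⟩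
    ∑ n (λ a → ∑ N (λ k → X a * ∑ n (λ b → Y b * F k a b)))
      ≡⟨ ∑-comm n N _ ⟩
    ∑ N (λ k → bilinear n (F k) X Y) ∎

  bilinear-rank-two : ∀ n (U V : ℕ → ℤ) (c : ℤ) (P Q X Y : ℕ → ℤ) →
    bilinear n (λ a b → U a * V b - c * P a * Q b) X Y ≡
    ∑ n (λ a → X a * U a) * ∑ n (λ b → Y b * V b) - c * ∑ n (λ a → X a * P a) * ∑ n (λ b → Y b * Q b)
  bilinear-rank-two n U V c P Q X Y = begin
    ∑ n (λ a → X a * ∑ n (λ b → Y b * (U a * V b - c * P a * Q b)))
      ≡⟨ ∑-cong n (λ a → cong (X a *_) (inner a)) ⟩
    ∑ n (λ a → X a * (U a * ΣV - c * P a * ΣQ))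
      ≡⟨ ∑-cong n (λ a → split-form (X a) (U a) ΣV c (P a) ΣQ) ⟩
    ∑ n (λ a → ΣV * (X a * U a) + (- (c * ΣQ)) * (X a * P a))
      ≡⟨ ∑-distrib-+ n _ _ ⟩
    _ ≡⟨ cong₂ _+_ (∑-distribˡ-* n ΣV _) (∑-distribˡ-* n (- (c * ΣQ)) _) ⟨
    ΣV * ∑ n (λ a → X a * U a) + (- (c * ΣQ)) * ∑ n (λ a → X a * P a)
      ≡⟨ join-form′ (∑ n (λ a → X a * U a)) ΣV c (∑ n (λ a → X a * P a)) ΣQ ⟩
    _ ∎
    where
    ΣV ΣQ : ℤ
    ΣV = ∑ n (λ b → Y b * V b)
    ΣQ = ∑ n (λ b → Y b * Q b)
    inner : ∀ a → ∑ n (λ b → Y b * (U a * V b - c * P a * Q b)) ≡ U a * ΣV - c * P a * ΣQ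
    inner a = begin
      _ ≡⟨ ∑-cong n (λ b → split-form′ (Y b) (U a) (V b) c (P a) (Q b)) ⟩
      _ ≡⟨ ∑-distrib-+ n _ _ ⟩
      _ ≡⟨ cong₂ _+_ (∑-distribˡ-* n (U a) _) (∑-distribˡ-* n (- (c * P a)) _) ⟨
      U a * ΣV + (- (c * P a)) * ΣQ ≡⟨ join-form (U a) ΣV c (P a) ΣQ ⟩
      _ ∎

  module Levels (b : ℕ → ℤ) where

    -- If b h is 1 or 0 according to whether peaks of height h are forbidden, then level (suc h) n counts
    -- the admissible ways to continue from height h to the final point with n up-steps; level 0 is the
    -- series 1, which makes the recurrence uniform.
    abstract
      level : ℕ → ℕ → ℤ
      level h zero = 1ℤ
      level zero (suc n) = 0ℤ
      level (suc h) (suc n) = level (2+ h) n - b (suc h) * level (suc h) n + level h (suc n)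

      level-zero : ∀ h → level h 0 ≡ 1ℤ
      level-zero h = refl

      level-0-suc : ∀ n → level 0 (suc n) ≡ 0ℤ
      level-0-suc n = refl

      level-suc : ∀ h n → level (suc h) (suc n) ≡ level (2+ h) n - b (suc h) * level (suc h) n + level h (suc n)
      level-suc h n = refl

    A B : ℕ → ℕ → ℤ
    A k = shift k (level (suc (double k)))
    B k = shift k (level (double k))

    A-suc : ∀ k i → A k (suc i) ≡ B k (suc i) + B (suc k) (suc i) - b (suc (double k)) * A k i
    A-suc k i = shift-recurrence k _ _ _ (b (suc (double k)))
      (trans (level-zero _) (sym (level-zero _))) (level-suc (double k)) i

    B-suc : ∀ k i → B (suc k) (suc i) ≡ A k i + A (suc k) i - b (double (suc k)) * B (suc k) i
    B-suc k zero = trans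
      (shift-zero-cong k _ _ (trans (level-zero (double (suc k))) (sym (level-zero (suc (double k))))))
      (no-correction (A k 0) (b (double (suc k))))
    B-suc k (suc i) = shift-recurrence k _ _ _ (b (double (suc k)))
      (trans (level-zero _) (sym (level-zero _))) (level-suc (suc (double k))) i

    private
      drop-correction : ∀ x y z → x + y - 0ℤ * z ≡ x + y
      drop-correction = solve-∀

    A≡B+B : ∀ k → b (suc (double k)) ≡ 0ℤ → ∀ i → A k i ≡ B k i + B (suc k) i
    A≡B+B k b≡0 zero = trans
      (shift-zero-cong k _ _ (trans (level-zero (suc (double k))) (sym (level-zero (double k)))))
      (sym (+-identityʳ (B k 0)))
    A≡B+B k b≡0 (suc i) = begin
      A k (suc i) ≡⟨ A-suc k i ⟩
      _ ≡⟨ cong (λ c → B k (suc i) + B (suc k) (suc i) - c * A k i) b≡0 ⟩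
      _ ≡⟨ drop-correction (B k (suc i)) (B (suc k) (suc i)) (A k i) ⟩
      B k (suc i) + B (suc k) (suc i) ∎

    -- Pairs of half paths meeting at height 2k, corrected by those whose peak at height 2k + 2 is forbidden.
    term : ℕ → ℕ → ℕ → ℤ
    term k i j = A k i * A k j - b (double (suc k)) * B (suc k) i * B (suc k) j

    Gram : ℕ → ℕ → ℕ → ℤ
    Gram N i j = ∑ N (λ k → term k i j)

    private
      gram-base : ∀ x y → 0ℤ ≡ 0ℤ + (x * 0ℤ - 0ℤ * y)
      gram-base = solve-∀
      -- `β` and `o` belong to the heights 2N + 2 and 2N + 1. The terms with `o` are symmetric in
      -- the two halves and cancel, so forbidden odd heights need no correction in `term`.
      gram-step : ∀ G ai aj β Bi Bj B′i B′j Bi⁺ Bj⁺ a⁺i a⁺j o →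
        G + (ai * Bj⁺ - Bi⁺ * aj) + ((Bi⁺ + (ai + a⁺i - β * B′i) - o * ai) * aj - β * (ai + a⁺i - β * B′i) * B′j)
        ≡ G + (ai * (Bj⁺ + (aj + a⁺j - β * B′j) - o * aj) - β * B′i * (aj + a⁺j - β * B′j))
          + (a⁺i * (aj + a⁺j - β * B′j) - (ai + a⁺i - β * B′i) * a⁺j)
      gram-step = solve-∀

    -- Discrete integration by parts: handing two steps from one half path to the other changes each
    -- level only by a flux to its neighbours, and the fluxes telescope to the one at level `N`.
    Gram-step : ∀ N i j → Gram N (suc i) j ≡ Gram N i (suc j) + (A N i * B N (suc j) - B N (suc i) * A N j)
    Gram-step zero i j = begin
      Gram 0 (suc i) j ≡⟨ ∑-zero _ ⟩
      0ℤ ≡⟨ gram-base (A 0 i) (A 0 j) ⟩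
      0ℤ + (A 0 i * 0ℤ - 0ℤ * A 0 j)
        ≡⟨ cong₂ (λ x y → x + y) (∑-zero _) (cong₂ (λ x y → A 0 i * x - y * A 0 j) (level-0-suc j) (level-0-suc i)) ⟨
      Gram 0 i (suc j) + (A 0 i * B 0 (suc j) - B 0 (suc i) * A 0 j) ∎
    Gram-step (suc N) i j = begin
      Gram (suc N) (suc i) j
        ≡⟨ ∑-last N _ ⟩
      Gram N (suc i) j + (A N (suc i) * A N j - β * B (suc N) (suc i) * B (suc N) j)
        ≡⟨ cong₂ _+_ (Gram-step N i j) (cong₂ (λ x y → x * A N j - β * y * B (suc N) j) (A-suc′ i) (B-suc N i)) ⟩
      _ ≡⟨ gram-step (Gram N i (suc j)) (A N i) (A N j) β (B N i) (B N j) (B (suc N) i) (B (suc N) j)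
             (B N (suc i)) (B N (suc j)) (A (suc N) i) (A (suc N) j) (b (suc (double N))) ⟩
      _ ≡⟨ cong₂ _+_
             (cong (Gram N i (suc j) +_) (cong₂ (λ x y → A N i * x - β * B (suc N) i * y) (A-suc′ j) (B-suc N j)))
             (cong₂ (λ x y → A (suc N) i * x - y * A (suc N) j) (B-suc N j) (B-suc N i)) ⟨
      Gram N i (suc j) + term N i (suc j) + (A (suc N) i * B (suc N) (suc j) - B (suc N) (suc i) * A (suc N) j)
        ≡⟨ cong (_+ (A (suc N) i * B (suc N) (suc j) - B (suc N) (suc i) * A (suc N) j)) (∑-last N _) ⟨
      Gram (suc N) i (suc j) + (A (suc N) i * B (suc N) (suc j) - B (suc N) (suc i) * A (suc N) j) ∎
      where
      β : ℤ
      β = b (double (suc N))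
      A-suc′ : ∀ i → A N (suc i) ≡ B N (suc i) + (A N i + A (suc N) i - β * B (suc N) i) - b (suc (double N)) * A N i
      A-suc′ i = trans (A-suc N i) (cong (λ x → B N (suc i) + x - b (suc (double N)) * A N i) (B-suc N i))

    private
      first-term : ∀ a c x → 1ℤ * a - c * 0ℤ * x + 0ℤ ≡ a
      first-term = solve-∀
      later-term : ∀ x c y → 0ℤ * x - c * 0ℤ * y ≡ 0ℤ
      later-term = solve-∀
      no-boundary : ∀ g x y → g + (0ℤ * x - y * 0ℤ) ≡ g
      no-boundary = solve-∀

    -- Both halves are too short to reach level `N`, so the flux of `Gram-step` vanishes and the
    -- meeting point slides to the start, where only level 0 contributes.
    Gram≡level : ∀ N i j → i ℕ.+ j < N → Gram N i j ≡ level 1 (i ℕ.+ j)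
    Gram≡level (suc N) zero j _ = begin
      Gram (suc N) 0 j ≡⟨ ∑-suc N _ ⟩
      level 1 0 * level 1 j - b 2 * 0ℤ * B 1 j + ∑ N (λ k → term (suc k) 0 j)
        ≡⟨ cong₂ (λ x y → x * level 1 j - b 2 * 0ℤ * B 1 j + y) (level-zero 1)
             (∑-vanish N λ k → later-term (A (suc k) j) (b (double (2+ k))) (B (2+ k) j)) ⟩
      1ℤ * level 1 j - b 2 * 0ℤ * B 1 j + 0ℤ ≡⟨ first-term (level 1 j) (b 2) (B 1 j) ⟩
      level 1 j ∎
    Gram≡level N (suc i) j i+j<N = begin
      Gram N (suc i) j
        ≡⟨ Gram-step N i j ⟩
      Gram N i (suc j) + (A N i * B N (suc j) - B N (suc i) * A N j)
        ≡⟨ cong₂ (λ x y → Gram N i (suc j) + (x * B N (suc j) - B N (suc i) * y))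
             (shift-< N _ i (ℕ.≤-<-trans (ℕ.m≤n⇒m≤1+n (ℕ.m≤m+n i j)) i+j<N))
             (shift-< N _ j (ℕ.≤-<-trans (ℕ.m≤n+m j (suc i)) i+j<N)) ⟩
      Gram N i (suc j) + (0ℤ * B N (suc j) - B N (suc i) * 0ℤ)
        ≡⟨ no-boundary (Gram N i (suc j)) (B N (suc j)) (B N (suc i)) ⟩
      Gram N i (suc j)
        ≡⟨ Gram≡level N i (suc j) (subst (_< N) (sym (ℕ.+-suc i j)) i+j<N) ⟩
      level 1 (i ℕ.+ suc j)
        ≡⟨ cong (level 1) (ℕ.+-suc i j) ⟩
      level 1 (suc i ℕ.+ j) ∎

    module Periodic (p : ℕ) (periodic : ∀ h → b (double p ℕ.+ suc h) ≡ b (suc h)) where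

      private
        W : ℕ → ℤ
        W = level (double p)
        regroup : ∀ w r c a q → w * 1ℤ + (r - c * a + q) ≡ r - c * a + (w * 1ℤ + q)
        regroup = solve-∀

      -- First-passage decomposition. Since `level q` counts paths from height `q - 1`, a path
      -- counted on the left stays at height `double p` or above until it first steps below. That
      -- portion sees the forbidden heights translated by a period and is counted by `level h`, the
      -- rest by `W`.
      level-period : ∀ h n → level (double p ℕ.+ h) n ≡ convolution W (level h) n
      level-period h zero = trans (level-zero _) (sym (cong₂ _*_ (level-zero (double p)) (level-zero h)))
      level-period zero (suc n) = begin
        level (double p ℕ.+ 0) (suc n) ≡⟨ cong (λ q → level q (suc n)) (ℕ.+-identityʳ (double p)) ⟩
        W (suc n) ≡⟨ *-identityʳ (W (suc n)) ⟨
        W (suc n) * 1ℤ ≡⟨ +-identityʳ (W (suc n) * 1ℤ) ⟨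
        W (suc n) * 1ℤ + 0ℤ ≡⟨ cong₂ (λ x y → W (suc n) * x + y) (level-zero 0) (vanish n (level-0-suc)) ⟨
        convolution W (level 0) (suc n) ∎
        where
        vanish : ∀ {Q} n → (∀ i → Q i ≡ 0ℤ) → convolution W Q n ≡ 0ℤ
        vanish zero eq = trans (cong (W 0 *_) (eq 0)) (*-zeroʳ (W 0))
        vanish (suc n) eq = cong₂ _+_ (trans (cong (W (suc n) *_) (eq 0)) (*-zeroʳ (W (suc n)))) (vanish n (λ i → eq (suc i)))
      level-period (suc h) (suc n) = begin
        level (q ℕ.+ suc h) (suc n)
          ≡⟨ cong (λ x → level x (suc n)) (ℕ.+-suc q h) ⟩
        level (suc (q ℕ.+ h)) (suc n)
          ≡⟨ level-suc (q ℕ.+ h) n ⟩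
        level (2+ (q ℕ.+ h)) n - b (suc (q ℕ.+ h)) * level (suc (q ℕ.+ h)) n + level (q ℕ.+ h) (suc n)
          ≡⟨ cong₂ (λ x y → x - y + level (q ℕ.+ h) (suc n))
               (trans (cong (λ x → level x n) (sym (trans (ℕ.+-suc q (suc h)) (cong suc (ℕ.+-suc q h)))))
                 (level-period (2+ h) n))
               (cong₂ _*_ (trans (cong b (sym (ℕ.+-suc q h))) (periodic h))
                 (trans (cong (λ x → level x n) (sym (ℕ.+-suc q h))) (level-period (suc h) n))) ⟩
        convolution W (level (2+ h)) n - b (suc h) * convolution W (level (suc h)) n + level (q ℕ.+ h) (suc n)
          ≡⟨ cong (convolution W (level (2+ h)) n - b (suc h) * convolution W (level (suc h)) n +_)
               (trans (level-period h (suc n)) (cong (λ x → W (suc n) * x + convolution W (level h ∘ suc) n) (level-zero h))) ⟩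
        convolution W (level (2+ h)) n - b (suc h) * convolution W (level (suc h)) n
          + (W (suc n) * 1ℤ + convolution W (level h ∘ suc) n)
          ≡⟨ regroup (W (suc n)) (convolution W (level (2+ h)) n) (b (suc h))
               (convolution W (level (suc h)) n) (convolution W (level h ∘ suc) n) ⟨
        W (suc n) * 1ℤ + (convolution W (level (2+ h)) n - b (suc h) * convolution W (level (suc h)) n
          + convolution W (level h ∘ suc) n)
          ≡⟨ cong₂ (λ x y → W (suc n) * x + y) (level-zero (suc h))
               (convolution-linear W (level (2+ h)) (b (suc h)) (level (suc h)) (level h ∘ suc) (level-suc h) n) ⟨
        convolution W (level (suc h)) (suc n) ∎
        where
        q : ℕ
        q = double p

      pullback : ℕ → ℕ → ℤ
      pullback i a = shift (p ℕ.+ a) W i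

      A-period : ∀ n k i → i < p ℕ.+ n → A (p ℕ.+ k) i ≡ ∑ n (λ a → pullback i a * A k a)
      A-period n k i i<p+n = begin
        shift (p ℕ.+ k) (level (suc (double (p ℕ.+ k)))) i
          ≡⟨ cong (λ x → shift (p ℕ.+ k) (level x) i)
               (trans (cong suc (double-+ p k)) (sym (ℕ.+-suc (double p) (double k)))) ⟩
        shift (p ℕ.+ k) (level (double p ℕ.+ suc (double k))) i
          ≡⟨ shift-cong (p ℕ.+ k) (level-period (suc (double k))) i ⟩
        shift (p ℕ.+ k) (convolution W (level (suc (double k)))) i
          ≡⟨ convolution-shift p k n W (level (suc (double k))) i i<p+n ⟩
        _ ∎

      B-period : ∀ n k i → i < p ℕ.+ n → B (p ℕ.+ k) i ≡ ∑ n (λ a → pullback i a * B k a)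
      B-period n k i i<p+n = begin
        shift (p ℕ.+ k) (level (double (p ℕ.+ k))) i
          ≡⟨ cong (λ x → shift (p ℕ.+ k) (level x) i) (double-+ p k) ⟩
        shift (p ℕ.+ k) (level (double p ℕ.+ double k)) i
          ≡⟨ shift-cong (p ℕ.+ k) (level-period (double k)) i ⟩
        shift (p ℕ.+ k) (convolution W (level (double k))) i
          ≡⟨ convolution-shift p k n W (level (double k)) i i<p+n ⟩
        _ ∎

      -- From level `p` on all series are multiples of `W`, so each term is the pullback of the term
      -- `p` levels below. Summed over all levels, the tail is the complete Hankel form again, now
      -- of order `n`.
      Gram-period : ∀ n i j → i < p ℕ.+ n → j < p ℕ.+ n →
        level 1 (i ℕ.+ j) ≡
        Gram p i j + bilinear n (λ a b → level 1 (a ℕ.+ b)) (pullback i) (pullback j)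
      Gram-period n i j i< j< = begin
        level 1 (i ℕ.+ j)
          ≡⟨ Gram≡level (p ℕ.+ N) i j (ℕ.<-≤-trans (ℕ.+-mono-< i< j<) large) ⟨
        Gram (p ℕ.+ N) i j
          ≡⟨ ∑-split p N _ ⟩
        Gram p i j + ∑ N (λ k → term (p ℕ.+ k) i j)
          ≡⟨ cong (Gram p i j +_) (∑-cong N λ k → begin
               term (p ℕ.+ k) i j
                 ≡⟨ cong₂ _-_ (cong₂ _*_ (A-period n k i i<) (A-period n k j j<))
                      (cong₂ _*_ (cong₂ _*_ (b-period k) (B-period′ k i i<)) (B-period′ k j j<)) ⟩
               _ ≡⟨ bilinear-rank-two n (A k) (A k) (b (double (suc k))) (B (suc k)) (B (suc k)) (pullback i) (pullback j) ⟨
               bilinear n (term k) (pullback i) (pullback j) ∎) ⟩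
        Gram p i j + ∑ N (λ k → bilinear n (term k) (pullback i) (pullback j))
          ≡⟨ cong (Gram p i j +_) (bilinear-∑ n N term (pullback i) (pullback j)) ⟨
        Gram p i j + bilinear n (Gram N) (pullback i) (pullback j)
          ≡⟨ cong (Gram p i j +_) (∑-cong-< n λ a a<n → cong (pullback i a *_) (∑-cong-< n λ b b<n →
               cong (pullback j b *_) (Gram≡level N a b (ℕ.<-≤-trans (ℕ.+-mono-< a<n b<n) (ℕ.m≤n+m (n ℕ.+ n) (p ℕ.+ p)))))) ⟩
        Gram p i j + bilinear n (λ a b → level 1 (a ℕ.+ b)) (pullback i) (pullback j) ∎
        where
        -- Large enough for both uses of `Gram≡level`: `p + N` levels for indices below `p + n`, and
        -- `N` levels for the pulled back form with indices below `n`.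
        N : ℕ
        N = (p ℕ.+ p) ℕ.+ (n ℕ.+ n)
        large : (p ℕ.+ n) ℕ.+ (p ℕ.+ n) ≤ p ℕ.+ N
        large = ℕ.≤-trans (ℕ.≤-reflexive (rearrange p n)) (ℕ.m≤n+m N p)
          where
          open import Data.Nat.Tactic.RingSolver renaming (solve-∀ to solve-ℕ)
          rearrange : ∀ p n → (p ℕ.+ n) ℕ.+ (p ℕ.+ n) ≡ (p ℕ.+ p) ℕ.+ (n ℕ.+ n)
          rearrange = solve-ℕ
        b-period : ∀ k → b (double (suc (p ℕ.+ k))) ≡ b (double (suc k))
        b-period k = trans
          (cong b (trans (cong 2+ (double-+ p k))
            (sym (trans (ℕ.+-suc (double p) (suc (double k))) (cong suc (ℕ.+-suc (double p) (double k)))))))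
          (periodic (suc (double k)))
        B-period′ : ∀ k i → i < p ℕ.+ n → B (suc (p ℕ.+ k)) i ≡ ∑ n (λ a → pullback i a * B (suc k) a)
        B-period′ k i i< = trans (cong (λ x → B x i) (sym (ℕ.+-suc p k))) (B-period n (suc k) i i<)

-- Elimination of the degenerate direction and the shift of Hankel determinants.

module HankelReduction where

  open FiniteSums
  open Determinants
  open BorderedMatrices
  open LevelSeries
  open import Data.Nat using (ℕ; zero; suc; 2+; _<_; _≤_; s≤s)
  import Data.Nat as ℕ
  import Data.Nat.Properties as ℕ
  open import Data.Integer using (ℤ; _+_; _*_; -_; _-_; 0ℤ; 1ℤ; -1ℤ)
  open import Data.Integer.Properties
  open import Data.Integer.Tactic.RingSolver using (solve-∀)
  open import Data.Product using (_,_)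
  open import Data.Sum using (inj₁; inj₂)
  open import Function using (_∘_)
  open import Relation.Binary.PropositionalEquality
  open import Relation.Nullary using (yes; no)
  open ≡-Reasoning

  splice : ∀ {X : Set} → ℕ → (f g : ℕ → X) → ℕ → X
  splice zero f g k = g k
  splice (suc r) f g zero = f zero
  splice (suc r) f g (suc k) = splice r (f ∘ suc) (g ∘ suc) k

  splice-< : ∀ {X : Set} r (f g : ℕ → X) {k} → k < r → splice r f g k ≡ f k
  splice-< (suc r) f g {zero} _ = refl
  splice-< (suc r) f g {suc k} (s≤s k<r) = splice-< r (f ∘ suc) (g ∘ suc) k<r

  splice-≥ : ∀ {X : Set} r (f g : ℕ → X) {k} → r ≤ k → splice r f g k ≡ g k
  splice-≥ zero f g _ = refl
  splice-≥ (suc r) f g {suc k} (s≤s r≤k) = splice-≥ r (f ∘ suc) (g ∘ suc) r≤k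

  -- The leading principal minors of the tridiagonal matrix with off-diagonal entries 1 and diagonal
  -- entries 1, 2 - β 1, 2 - β 2, …
  leading : (ℕ → ℤ) → ℕ → ℤ
  leading β zero = 1ℤ
  leading β (suc zero) = 1ℤ
  leading β (2+ k) = (1ℤ + 1ℤ - β (suc k)) * leading β (suc k) - leading β k

  private
    cancel-initial : ∀ u → - (1ℤ * 1ℤ * u + -1ℤ * 1ℤ * 1ℤ * u) ≡ 0ℤ
    cancel-initial = solve-∀
    kernel-step : ∀ s u β c d →
      (-1ℤ * (-1ℤ * s)) * ((1ℤ + 1ℤ - β) * d - c) * u ≡
      - ((1ℤ + 1ℤ - β) * (-1ℤ * s * d * u) + s * c * u)
    kernel-step = solve-∀
    kernel-end : ∀ s c → - ((s * c) * (s * c) + -1ℤ * s * c * (s * c)) ≡ 0ℤ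
    kernel-end = solve-∀
    square-product : ∀ s c → s * c * (s * c) ≡ (s * s) * (c * c)
    square-product = solve-∀
    sgn-step : ∀ s → (-1ℤ * s) * (-1ℤ * s) ≡ s * s
    sgn-step = solve-∀
    subtract-itself : ∀ x → x - 1ℤ * x ≡ 0ℤ
    subtract-itself = solve-∀
    elimination-base : ∀ e f g h c → 0ℤ ≡ 0ℤ + (0ℤ * e * f + 0ℤ * (e * h + f * g) + 0ℤ * c * g * h)
    elimination-base = solve-∀
    -- Here `x`, `y`, `z` stand for `B m`, `B (suc m)`, `B r` at `i`, the primed ones for the same
    -- at `j`, and `c`, `d` for `κ m`, `κ (suc m)`; the innermost negated bracket is `κ (2+ m)`.
    elimination-step : ∀ S ρ β c d x x′ y y′ z z′ →
      S + (ρ * (x - c * z) * (x′ - c * z′) + - (c + d) * ((x - c * z) * z′ + (x′ - c * z′) * z) + - (c + d) * c * z * z′)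
        + ((x + y) * (x′ + y′) - β * y * y′)
      ≡ S + ((1ℤ + ρ) * (x - c * z) * (x′ - c * z′) + 1ℤ * ((x - c * z) * (y′ - d * z′) + (y - d * z) * (x′ - c * z′)))
        + ((1ℤ - β) * (y - d * z) * (y′ - d * z′)
          + - (d + - ((1ℤ + 1ℤ - β) * d + c)) * ((y - d * z) * z′ + (y′ - d * z′) * z)
          + - (d + - ((1ℤ + 1ℤ - β) * d + c)) * d * z * z′)
    elimination-step = solve-∀
    elimination-end : ∀ S ρ c z z′ → S + (ρ * 0ℤ * 0ℤ + 0ℤ * (0ℤ * z′ + 0ℤ * z) + 0ℤ * c * z * z′) ≡ S
    elimination-end = solve-∀
    vanishing-coupling : ∀ s e f → s * e * f + 0ℤ * (e * 0ℤ + 0ℤ * f) ≡ s * e * f + 1ℤ * (e * 0ℤ + 0ℤ * f)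
    vanishing-coupling = solve-∀
    plain-square : ∀ a a′ x x′ B B′ → 1ℤ * a * a′ + 0ℤ * (a * x′ + x * a′) ≡ a * a′ - 0ℤ * B * B′
    plain-square = solve-∀
    unimodular : ∀ x y → x - y * 0ℤ ≡ x
    unimodular = solve-∀
    leading-form : ∀ β c d → (1ℤ + (1ℤ - β)) * d - 1ℤ * 1ℤ * c ≡ (1ℤ + 1ℤ - β) * d - c
    leading-form = solve-∀
    constant-form : ∀ c d → 1ℤ * c - 0ℤ * 0ℤ * d ≡ c
    constant-form = solve-∀

  sgn-square : ∀ k → sgn k * sgn k ≡ 1ℤ
  sgn-square zero = refl
  sgn-square (suc k) = trans (sgn-step (sgn k)) (sgn-square k)

  module _ (b : ℕ → ℤ) (r₀ s : ℕ) where

    private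
      r p : ℕ
      r = suc r₀
      p = r ℕ.+ s
      β : ℕ → ℤ
      β k = b (double k)
      c : ℕ → ℤ
      c = leading β

    open Levels b

    module _
      (periodic : ∀ h → b (double p ℕ.+ suc h) ≡ b (suc h))
      (odd-free : ∀ k → k < r → b (suc (double k)) ≡ 0ℤ)
      (even-free : ∀ k → r ≤ k → k < p → β (suc k) ≡ 0ℤ)
      (stationary : c (suc r) ≡ c r)
      (unit : c r * c r ≡ 1ℤ)
      where

      open Periodic p periodic

      private

        -- Leading minors with alternating signs solve, row by row, the kernel equations of a
        -- tridiagonal matrix with off-diagonal entries 1. The factor `sgn r * c r` is a sign that
        -- makes the coordinate at `r` equal to 1.
        κ : ℕ → ℤ
        κ k = sgn k * c k * (sgn r * c r)

        -- Combination of the B k that removes B r: the quadratic form of the first r levels,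
        -- expressed in B 0, …, B r, is degenerate with kernel spanned by κ.
        e : ℕ → ℕ → ℤ
        e k i = B k i - κ k * B r i

        -- The share of level `k - 1` in the diagonal entry at `B k`; level `k` adds the remaining
        -- 1.
        ρ : ℕ → ℤ
        ρ zero = 0ℤ
        ρ (suc k) = 1ℤ - β (suc k)

        -- Row `k` of the form of the first `k` levels, applied to `κ`. Level `k` would add
        -- `κ k + κ (suc k)` and complete the row to zero.
        y : ℕ → ℤ
        y k = - (κ k + κ (suc k))

        κ-step : ∀ k → κ (2+ k) ≡ - ((1ℤ + 1ℤ - β (suc k)) * κ (suc k) + κ k)
        κ-step k = kernel-step (sgn k) (sgn r * c r) (β (suc k)) (c k) (c (suc k))

        κ-end : κ r ≡ 1ℤ
        κ-end = trans (square-product (sgn r) (c r)) (cong₂ _*_ (sgn-square r) unit)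

        -- The last row equation is not built into the recurrence for `κ`: it expresses the
        -- degeneracy, and `stationary` supplies it.
        y-end : y r ≡ 0ℤ
        y-end = begin
          - ((sgn r * c r) * (sgn r * c r) + -1ℤ * sgn r * c (suc r) * (sgn r * c r))
            ≡⟨ cong (λ x → - ((sgn r * c r) * (sgn r * c r) + -1ℤ * sgn r * x * (sgn r * c r))) stationary ⟩
          - ((sgn r * c r) * (sgn r * c r) + -1ℤ * sgn r * c r * (sgn r * c r))
            ≡⟨ kernel-end (sgn r) (c r) ⟩
          0ℤ ∎

        e-end : ∀ i → e r i ≡ 0ℤ
        e-end i = trans (cong (λ x → B r i - x * B r i) κ-end) (subtract-itself (B r i))

        form : ℕ → ℕ → ℕ → ℤ
        form i j k = (1ℤ + ρ k) * e k i * e k j + 1ℤ * (e k i * e (suc k) j + e (suc k) i * e k j)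

        boundary : ℕ → ℕ → ℕ → ℤ
        boundary i j k = ρ k * e k i * e k j + y k * (e k i * B r j + e k j * B r i) + y k * κ k * B r i * B r j

        -- Substitute `B k = e k + κ k * B r`. Rows of index less than `m` are complete and
        -- annihilate `κ`, so they lose every mixed term with `B r`; only the incomplete row `m`
        -- keeps a remainder.
        elimination : ∀ m → m ≤ r → ∀ i j → Gram m i j ≡ ∑ m (form i j) + boundary i j m
        elimination zero _ i j = begin
          Gram 0 i j ≡⟨ ∑-zero _ ⟩
          0ℤ ≡⟨ elimination-base (e 0 i) (e 0 j) (B r i) (B r j) (κ 0) ⟩
          0ℤ + (0ℤ * e 0 i * e 0 j + 0ℤ * (e 0 i * B r j + e 0 j * B r i) + 0ℤ * κ 0 * B r i * B r j)
            ≡⟨ cong₂ (λ x y → x + (0ℤ * e 0 i * e 0 j + y * (e 0 i * B r j + e 0 j * B r i) + y * κ 0 * B r i * B r j))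
                 (∑-zero _) (cancel-initial (sgn r * c r)) ⟨
          ∑ 0 (form i j) + boundary i j 0 ∎
        elimination (suc m) m<r i j = begin
          Gram (suc m) i j
            ≡⟨ ∑-last m _ ⟩
          Gram m i j + (A m i * A m j - β (suc m) * B (suc m) i * B (suc m) j)
            ≡⟨ cong₂ _+_ (elimination m (ℕ.<⇒≤ m<r) i j)
                 (cong₂ (λ u v → u * v - β (suc m) * B (suc m) i * B (suc m) j)
                   (A≡B+B m (odd-free m m<r) i) (A≡B+B m (odd-free m m<r) j)) ⟩
          _ ≡⟨ elimination-step (∑ m (form i j)) (ρ m) (β (suc m)) (κ m) (κ (suc m))
                 (B m i) (B m j) (B (suc m) i) (B (suc m) j) (B r i) (B r j) ⟩
          _ ≡⟨ cong₂ (λ u v → u + ((1ℤ - β (suc m)) * e (suc m) i * e (suc m) j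
                 + - (κ (suc m) + v) * (e (suc m) i * B r j + e (suc m) j * B r i)
                 + - (κ (suc m) + v) * κ (suc m) * B r i * B r j))
                 (∑-last m (form i j)) (κ-step m) ⟨
          ∑ (suc m) (form i j) + boundary i j (suc m) ∎

        Gram-run : ∀ i j → Gram r i j ≡ ∑ r (form i j)
        Gram-run i j = begin
          Gram r i j ≡⟨ elimination r ℕ.≤-refl i j ⟩
          ∑ r (form i j) + boundary i j r
            ≡⟨ cong (∑ r (form i j) +_) (cong₂ _+_ (cong₂ _+_
                 (cong₂ (λ u v → ρ r * u * v) (e-end i) (e-end j))
                 (cong₂ _*_ y-end (cong₂ (λ u v → u * B r j + v * B r i) (e-end i) (e-end j))))
                 (cong (λ u → u * κ r * B r i * B r j) y-end)) ⟩
          _ ≡⟨ elimination-end (∑ r (form i j)) (ρ r) (κ r) (B r i) (B r j) ⟩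
          ∑ r (form i j) ∎

        -- In each of the three ranges vector `k` starts with x^k, with coefficient 1. Since `e r`
        -- is zero, index `r` is free for the next range; from `p` on, `basis (p + k) i` is
        -- `pullback i k`.
        basis : ℕ → ℕ → ℤ
        basis = splice r e (splice p A (λ k → shift k (level (double p))))

        σ τ : ℕ → ℤ
        σ = splice r (λ k → 1ℤ + ρ k) (λ _ → 1ℤ)
        τ = splice r₀ (λ _ → 1ℤ) (λ _ → 0ℤ)

        σ-run : ∀ {k} → k < r → σ k ≡ 1ℤ + ρ k
        σ-run = splice-< r (λ k → 1ℤ + ρ k) (λ _ → 1ℤ)

        σ-free : ∀ {k} → r ≤ k → σ k ≡ 1ℤ
        σ-free = splice-≥ r (λ k → 1ℤ + ρ k) (λ _ → 1ℤ)

        τ-run : ∀ {k} → k < r₀ → τ k ≡ 1ℤ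
        τ-run = splice-< r₀ (λ _ → 1ℤ) (λ _ → 0ℤ)

        τ-free : ∀ {k} → r₀ ≤ k → τ k ≡ 0ℤ
        τ-free = splice-≥ r₀ (λ _ → 1ℤ) (λ _ → 0ℤ)

        basis-run : ∀ {k} → k < r → ∀ i → basis k i ≡ e k i
        basis-run k<r i = cong (λ f → f i) (splice-< r e _ k<r)

        basis-free : ∀ {k} → r ≤ k → k < p → ∀ i → basis k i ≡ A k i
        basis-free r≤k k<p i = cong (λ f → f i) (trans (splice-≥ r e _ r≤k) (splice-< p A _ k<p))

        basis-tail : ∀ {k} → p ≤ k → ∀ i → basis k i ≡ shift k (level (double p)) i
        basis-tail p≤k i = cong (λ f → f i)
          (trans (splice-≥ r e _ (ℕ.≤-trans (ℕ.m≤m+n r s) p≤k)) (splice-≥ p A _ p≤k))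

        basis-unitLower : UnitLower (λ i k → basis k i)
        basis-unitLower = diagonal , upper
          where
          diagonal : ∀ i → basis i i ≡ 1ℤ
          diagonal i with i ℕ.<? r
          ... | yes i<r = begin
            basis i i ≡⟨ basis-run i<r i ⟩
            B i i - κ i * B r i
              ≡⟨ cong₂ (λ u v → u - κ i * v) (trans (shift-diagonal i _) (level-zero _)) (shift-< r _ i i<r) ⟩
            1ℤ - κ i * 0ℤ ≡⟨ unimodular 1ℤ (κ i) ⟩
            1ℤ ∎
          ... | no i≮r with i ℕ.<? p
          ...   | yes i<p = trans (basis-free (ℕ.≮⇒≥ i≮r) i<p i) (trans (shift-diagonal i _) (level-zero _))
          ...   | no i≮p = trans (basis-tail (ℕ.≮⇒≥ i≮p) i) (trans (shift-diagonal i _) (level-zero _))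
          upper : ∀ i k → i < k → basis k i ≡ 0ℤ
          upper i k i<k with k ℕ.<? r
          ... | yes k<r = begin
            basis k i ≡⟨ basis-run k<r i ⟩
            B k i - κ k * B r i
              ≡⟨ cong₂ (λ u v → u - κ k * v) (shift-< k _ i i<k) (shift-< r _ i (ℕ.<-trans i<k k<r)) ⟩
            0ℤ - κ k * 0ℤ ≡⟨ unimodular 0ℤ (κ k) ⟩
            0ℤ ∎
          ... | no k≮r with k ℕ.<? p
          ...   | yes k<p = trans (basis-free (ℕ.≮⇒≥ k≮r) k<p i) (shift-< k _ i i<k)
          ...   | no k≮p = trans (basis-tail (ℕ.≮⇒≥ k≮p) i) (shift-< k _ i i<k)

        entry : ℕ → ℕ → ℕ → ℤ
        entry i j k = σ k * basis k i * basis k j + τ k * (basis k i * basis (suc k) j + basis (suc k) i * basis k j)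

        entry-run : ∀ i j k → k < r → entry i j k ≡ form i j k
        entry-run i j k (s≤s k≤r₀) with ℕ.m≤n⇒m<n∨m≡n k≤r₀
        ... | inj₁ k<r₀ = cong₂ _+_
          (cong₂ _*_ (cong₂ _*_ (σ-run (s≤s k≤r₀)) (now i)) (now j))
          (cong₂ _*_ (τ-run k<r₀) (cong₂ _+_ (cong₂ _*_ (now i) (next j)) (cong₂ _*_ (next i) (now j))))
          where
          now : ∀ i → basis k i ≡ e k i
          now = basis-run (s≤s k≤r₀)
          next : ∀ i → basis (suc k) i ≡ e (suc k) i
          next = basis-run (s≤s k<r₀)
        -- At the end of the run the coupling is 0 in `entry` but 1 in `form`: the neighbour in
        -- `basis` is no longer `e r`, while the neighbour in `form` is `e r`, which vanishes.
        ... | inj₂ refl = begin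
          entry i j k
            ≡⟨ cong₂ _+_
                 (cong₂ _*_ (cong₂ _*_ (σ-run (s≤s k≤r₀)) (now i)) (now j))
                 (cong (_* (basis k i * basis (suc k) j + basis (suc k) i * basis k j)) (τ-free ℕ.≤-refl)) ⟩
          (1ℤ + ρ k) * e k i * e k j + 0ℤ * (basis k i * basis (suc k) j + basis (suc k) i * basis k j)
            ≡⟨ cong ((1ℤ + ρ k) * e k i * e k j +_) (*-zeroˡ (basis k i * basis (suc k) j + basis (suc k) i * basis k j)) ⟩
          (1ℤ + ρ k) * e k i * e k j + 0ℤ * (e k i * 0ℤ + 0ℤ * e k j)
            ≡⟨ vanishing-coupling (1ℤ + ρ k) (e k i) (e k j) ⟩
          (1ℤ + ρ k) * e k i * e k j + 1ℤ * (e k i * 0ℤ + 0ℤ * e k j)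
            ≡⟨ cong₂ (λ u v → (1ℤ + ρ k) * e k i * e k j + 1ℤ * (e k i * u + v * e k j)) (e-end j) (e-end i) ⟨
          form i j k ∎
          where
          now : ∀ i → basis k i ≡ e k i
          now = basis-run (s≤s k≤r₀)

        entry-free : ∀ i j k → r ≤ k → k < p → entry i j k ≡ term k i j
        entry-free i j k r≤k k<p = begin
          entry i j k
            ≡⟨ cong₂ _+_
                 (cong₂ _*_ (cong₂ _*_ (σ-free r≤k) (basis-free r≤k k<p i)) (basis-free r≤k k<p j))
                 (cong₂ _*_ (τ-free (ℕ.≤-trans (ℕ.n≤1+n r₀) r≤k))
                   (cong₂ _+_ (cong (_* basis (suc k) j) (basis-free r≤k k<p i)) (cong (basis (suc k) i *_) (basis-free r≤k k<p j)))) ⟩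
          _ ≡⟨ plain-square (A k i) (A k j) (basis (suc k) i) (basis (suc k) j) (B (suc k) i) (B (suc k) j) ⟩
          A k i * A k j - 0ℤ * B (suc k) i * B (suc k) j
            ≡⟨ cong (λ x → A k i * A k j - x * B (suc k) i * B (suc k) j) (even-free k r≤k k<p) ⟨
          term k i j ∎

        ∑-entries : ∀ i j → ∑ p (entry i j) ≡ Gram p i j
        ∑-entries i j = begin
          ∑ (r ℕ.+ s) (entry i j)
            ≡⟨ ∑-split r s _ ⟩
          ∑ r (entry i j) + ∑ s (λ k → entry i j (r ℕ.+ k))
            ≡⟨ cong₂ _+_ (∑-cong-< r (entry-run i j))
                 (∑-cong-< s λ k k<s → entry-free i j (r ℕ.+ k) (ℕ.m≤m+n r k) (ℕ.+-monoʳ-< r k<s)) ⟩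
          ∑ r (form i j) + ∑ s (λ k → term (r ℕ.+ k) i j)
            ≡⟨ cong (_+ ∑ s (λ k → term (r ℕ.+ k) i j)) (Gram-run i j) ⟨
          Gram r i j + ∑ s (λ k → term (r ℕ.+ k) i j)
            ≡⟨ ∑-split r s _ ⟨
          Gram p i j ∎

        continuant-run : ∀ k → k ≤ r → continuant σ τ k ≡ c k
        continuant-run zero _ = refl
        continuant-run (suc zero) _ = refl
        continuant-run (2+ k) k+2≤r@(s≤s k+1≤r₀) = begin
          continuant σ τ (2+ k)
            ≡⟨ continuant-last k σ τ ⟩
          σ (suc k) * continuant σ τ (suc k) - τ k * τ k * continuant σ τ k
            ≡⟨ cong₂ _-_
                 (cong₂ _*_ (σ-run k+2≤r) (continuant-run (suc k) (ℕ.<⇒≤ k+2≤r)))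
                 (cong₂ (λ t x → t * t * x) (τ-run k+1≤r₀)
                   (continuant-run k (ℕ.≤-trans (ℕ.n≤1+n k) (ℕ.<⇒≤ k+2≤r)))) ⟩
          (1ℤ + (1ℤ - β (suc k))) * c (suc k) - 1ℤ * 1ℤ * c k
            ≡⟨ leading-form (β (suc k)) (c k) (c (suc k)) ⟩
          c (2+ k) ∎

        continuant-free : ∀ t → continuant σ τ (r ℕ.+ t) ≡ c r
        continuant-free zero = trans (cong (continuant σ τ) (ℕ.+-identityʳ r)) (continuant-run r ℕ.≤-refl)
        continuant-free (suc t) = begin
          continuant σ τ (r ℕ.+ suc t)
            ≡⟨ cong (continuant σ τ) (ℕ.+-suc r t) ⟩
          continuant σ τ (suc (r ℕ.+ t))
            ≡⟨ continuant-last (r₀ ℕ.+ t) σ τ ⟩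
          σ (r ℕ.+ t) * continuant σ τ (r ℕ.+ t) - τ (r₀ ℕ.+ t) * τ (r₀ ℕ.+ t) * continuant σ τ (r₀ ℕ.+ t)
            ≡⟨ cong₂ _-_
                 (cong₂ _*_ (σ-free (ℕ.m≤m+n r t)) (continuant-free t))
                 (cong (λ x → x * x * continuant σ τ (r₀ ℕ.+ t)) (τ-free (ℕ.m≤m+n r₀ t))) ⟩
          1ℤ * c r - 0ℤ * 0ℤ * continuant σ τ (r₀ ℕ.+ t)
            ≡⟨ constant-form (c r) (continuant σ τ (r₀ ℕ.+ t)) ⟩
          c r ∎

      Hankel-shift : ∀ n →
        Det (suc (p ℕ.+ n)) (λ i j → level 1 (i ℕ.+ j)) ≡ c r * Det (suc n) (λ i j → level 1 (i ℕ.+ j))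
      Hankel-shift n = begin
        Det N T
          ≡⟨ Det-cong-< N (λ i j i<N j<N → factorisation i j (subst (i <_) size i<N) (subst (j <_) size j<N)) ⟩
        Det N (λ i j → bilinear N S (λ k → basis k i) (λ k → basis k j))
          ≡⟨ Det-congruence N (λ i k → basis k i) S basis-unitLower ⟩
        Det N S
          ≡⟨ Det-border (r₀ ℕ.+ s) n σ τ T (τ-free (ℕ.m≤m+n r₀ s)) ⟩
        continuant σ τ p * Det (suc n) T
          ≡⟨ cong (_* Det (suc n) T) (continuant-free s) ⟩
        c r * Det (suc n) T ∎
        where
        N : ℕ
        N = suc (p ℕ.+ n)
        T S : Matrix
        T i j = level 1 (i ℕ.+ j)
        S = border σ τ p T
        size : N ≡ p ℕ.+ suc n
        size = sym (ℕ.+-suc p n)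
        factorisation : ∀ i j → i < p ℕ.+ suc n → j < p ℕ.+ suc n →
          T i j ≡ bilinear N S (λ k → basis k i) (λ k → basis k j)
        factorisation i j i< j< = begin
          T i j
            ≡⟨ Gram-period (suc n) i j i< j< ⟩
          Gram p i j + bilinear (suc n) T (pullback i) (pullback j)
            ≡⟨ cong₂ _+_ (sym (∑-entries i j)) (∑-cong (suc n) λ k →
                 cong₂ _*_ (sym (basis-tail (ℕ.m≤m+n p k) i)) (∑-cong (suc n) λ l →
                   cong (_* T k l) (sym (basis-tail (ℕ.m≤m+n p l) j)))) ⟩
          ∑ p (entry i j) + bilinear (suc n) T (λ k → basis (p ℕ.+ k) i) (λ k → basis (p ℕ.+ k) j)
            ≡⟨ bilinear-border p n σ τ T (λ k → basis k i) (λ k → basis k j) ⟨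
          bilinear N S (λ k → basis k i) (λ k → basis k j) ∎

-- Peak-restricted Dyck paths counted by the half-path series.

module PathCounting where

  open LevelSeries
  open import Data.Bool using (Bool; true; false; _∧_; not; if_then_else_)
  import Data.Bool as Bool
  open import Data.Bool.Properties using (∧-zeroʳ)
  open import Data.Bool.ListAction using (any)
  open import Data.List using (List; []; _∷_; _++_; map; length; filter)
  open import Data.Nat using (ℕ; zero; suc; 2+; _<_; s≤s; z≤n)
  import Data.Nat as ℕ
  import Data.Nat.Properties as ℕ
  open import Data.Integer using (ℤ; _+_; _*_; -_; _-_; 0ℤ; 1ℤ)
  import Data.Integer as ℤ
  open import Data.Integer.Properties
  open import Data.Integer.Tactic.RingSolver using (solve-∀)
  open import Function using (_∘_)
  open import Relation.Binary.PropositionalEquality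
  open ≡-Reasoning

  indicator : Bool → ℤ
  indicator x = if x then 1ℤ else 0ℤ

  count : (List Bool → Bool) → List (List Bool) → ℤ
  count P [] = 0ℤ
  count P (xs ∷ xss) = indicator (P xs) + count P xss

  count-++ : ∀ P xss yss → count P (xss ++ yss) ≡ count P xss + count P yss
  count-++ P [] yss = sym (+-identityˡ (count P yss))
  count-++ P (xs ∷ xss) yss = trans (cong (indicator (P xs) +_) (count-++ P xss yss))
    (sym (+-assoc (indicator (P xs)) (count P xss) (count P yss)))

  count-map : (P : List Bool → Bool) (f : List Bool → List Bool) (xss : List (List Bool)) → count P (map f xss) ≡ count (P ∘ f) xss
  count-map P f [] = refl
  count-map P f (xs ∷ xss) = cong (indicator (P (f xs)) +_) (count-map P f xss)

  count-cong : ∀ {P Q} → (∀ xs → P xs ≡ Q xs) → ∀ xss → count P xss ≡ count Q xss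
  count-cong eq [] = refl
  count-cong eq (xs ∷ xss) = cong₂ _+_ (cong indicator (eq xs)) (count-cong eq xss)

  count-none : ∀ xss → count (λ _ → false) xss ≡ 0ℤ
  count-none [] = refl
  count-none (xs ∷ xss) = trans (+-identityˡ _) (count-none xss)

  length-filter-filter : (P Q : List Bool → Bool) (xss : List (List Bool)) →
    ℤ.+ length (filter (λ xs → P xs Bool.≟ true) (filter (λ xs → Q xs Bool.≟ true) xss)) ≡
    count (λ xs → Q xs ∧ P xs) xss
  length-filter-filter P Q [] = refl
  length-filter-filter P Q (xs ∷ xss) with Q xs
  ... | false = trans (length-filter-filter P Q xss) (sym (+-identityˡ _))
  ... | true with P xs
  ...   | false = trans (length-filter-filter P Q xss) (sym (+-identityˡ _))
  ...   | true = cong (1ℤ +_) (length-filter-filter P Q xss)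

  module _ (bad : ℕ → Bool) where

    private
      b : ℕ → ℤ
      b h = indicator (bad h)

    open Levels b

    admissible : ℕ → List Bool → Bool
    admissible h xs = not (any bad (peakHeightsFrom h xs)) ∧ isDyckFrom h xs

    private
      paths : ℕ → (List Bool → Bool) → ℤ
      paths k P = count P (allPaths k)

      paths-suc : ∀ k P → paths (suc k) P ≡ paths k (P ∘ (true ∷_)) + paths k (P ∘ (false ∷_))
      paths-suc k P = trans (count-++ P (map (true ∷_) (allPaths k)) (map (false ∷_) (allPaths k)))
        (cong₂ _+_ (count-map P (true ∷_) (allPaths k)) (count-map P (false ∷_) (allPaths k)))

      number up down : ℕ → ℕ → ℤ
      number h k = paths k (admissible h)
      up h k = paths k (admissible h ∘ (true ∷_))
      down h k = paths k (admissible h ∘ (false ∷_))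

      -- `peakHeightsFrom` merely truncates at height 0; it is the factor `isDyckFrom` that rejects
      -- the path.
      down-zero : ∀ k → down 0 k ≡ 0ℤ
      down-zero k = trans
        (count-cong (λ xs → ∧-zeroʳ (not (any bad (peakHeightsFrom 0 xs)))) (allPaths k)) (count-none (allPaths k))

      combine-up : ∀ x y β → x + (1ℤ - β) * y ≡ (x + y) - β * y
      combine-up = solve-∀

      peak : ∀ h k → paths k (admissible h ∘ (true ∷_) ∘ (false ∷_)) ≡ (1ℤ - b (suc h)) * number h k
      peak h k with bad (suc h)
      ... | true = count-none (allPaths k)
      ... | false = sym (*-identityˡ (number h k))

      -- A peak shows only in the step after the up-step: of all continuations from `suc h`, those
      -- that come straight down are removed if that height is forbidden, and they continue from `h`
      -- with `k` steps.
      up-suc : ∀ h k → up h (suc k) ≡ number (suc h) (suc k) - b (suc h) * number h k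
      up-suc h k = begin
        up h (suc k)
          ≡⟨ paths-suc k (admissible h ∘ (true ∷_)) ⟩
        up (suc h) k + paths k (admissible h ∘ (true ∷_) ∘ (false ∷_))
          ≡⟨ cong (up (suc h) k +_) (peak h k) ⟩
        up (suc h) k + (1ℤ - b (suc h)) * number h k
          ≡⟨ combine-up (up (suc h) k) (number h k) (b (suc h)) ⟩
        up (suc h) k + number h k - b (suc h) * number h k
          ≡⟨ cong (_- b (suc h) * number h k) (paths-suc k (admissible (suc h))) ⟨
        number (suc h) (suc k) - b (suc h) * number h k ∎

      number-zero : ∀ k → number 0 (2+ k) ≡ number 1 (suc k) - b 1 * number 0 k
      number-zero k = begin
        number 0 (2+ k)                        ≡⟨ paths-suc (suc k) (admissible 0) ⟩
        up 0 (suc k) + down 0 (suc k)          ≡⟨ cong₂ _+_ (up-suc 0 k) (down-zero (suc k)) ⟩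
        number 1 (suc k) - b 1 * number 0 k + 0ℤ ≡⟨ +-identityʳ (number 1 (suc k) - b 1 * number 0 k) ⟩
        number 1 (suc k) - b 1 * number 0 k ∎

      number-suc : ∀ h k → number (suc h) (2+ k) ≡
        number (2+ h) (suc k) - b (2+ h) * number (suc h) k + number h (suc k)
      number-suc h k = trans (paths-suc (suc k) (admissible (suc h)))
        (cong (_+ number h (suc k)) (up-suc (suc h) k))

      number-one : ∀ h → number (suc h) 1 ≡ number h 0
      number-one h = trans (paths-suc 0 (admissible (suc h))) (+-identityˡ (number h 0))

      only-last : ∀ β x → 0ℤ - β * 0ℤ + x ≡ x
      only-last = solve-∀

      number-short : ∀ h k → k < h → number h k ≡ 0ℤ
      number-short (suc h) zero _ = refl
      number-short (2+ h) (suc zero) _ = trans (number-one (suc h)) (number-short (suc h) zero (s≤s z≤n))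
      number-short (suc h) (2+ k) (s≤s k+2≤h) = begin
        number (suc h) (2+ k) ≡⟨ number-suc h k ⟩
        number (2+ h) (suc k) - b (2+ h) * number (suc h) k + number h (suc k)
          ≡⟨ cong₂ (λ x y → x - b (2+ h) * y + number h (suc k))
               (number-short (2+ h) (suc k) (ℕ.m≤n⇒m≤1+n (ℕ.m≤n⇒m≤1+n k+2≤h)))
               (number-short (suc h) k (ℕ.m≤n⇒m≤1+n (ℕ.<⇒≤ k+2≤h))) ⟩
        0ℤ - b (2+ h) * 0ℤ + number h (suc k) ≡⟨ only-last (b (2+ h)) (number h (suc k)) ⟩
        number h (suc k) ≡⟨ number-short h (suc k) k+2≤h ⟩
        0ℤ ∎

      number-direct : ∀ h → number h h ≡ 1ℤ
      number-direct zero = refl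
      number-direct (suc zero) = number-one 0
      number-direct (2+ h) = begin
        number (2+ h) (2+ h) ≡⟨ number-suc (suc h) h ⟩
        number (suc (2+ h)) (suc h) - b (suc (2+ h)) * number (2+ h) h + number (suc h) (suc h)
          ≡⟨ cong₂ (λ x y → x - b (suc (2+ h)) * y + number (suc h) (suc h))
               (number-short (suc (2+ h)) (suc h) (s≤s (s≤s (ℕ.n≤1+n h))))
               (number-short (2+ h) h (s≤s (ℕ.n≤1+n h))) ⟩
        0ℤ - b (suc (2+ h)) * 0ℤ + number (suc h) (suc h) ≡⟨ only-last (b (suc (2+ h))) (number (suc h) (suc h)) ⟩
        number (suc h) (suc h) ≡⟨ number-direct (suc h) ⟩
        1ℤ ∎

      -- A path from height `h` with `n` up-steps has length `h + 2n`. The recurrence leads to a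
      -- lower height with the same `n` or to a smaller `n`, hence the induction on `n` outside and
      -- `h` inside.
      level-number : ∀ n h → level (suc h) n ≡ number h (h ℕ.+ double n)
      level-number zero h = trans (level-zero (suc h))
        (sym (trans (cong (number h) (ℕ.+-identityʳ h)) (number-direct h)))
      level-number (suc n) zero = begin
        level 1 (suc n) ≡⟨ level-suc 0 n ⟩
        level 2 n - b 1 * level 1 n + level 0 (suc n)
          ≡⟨ cong₂ _+_ (cong₂ (λ x y → x - b 1 * y) (level-number n 1) (level-number n 0)) (level-0-suc n) ⟩
        number 1 (suc (double n)) - b 1 * number 0 (double n) + 0ℤ
          ≡⟨ +-identityʳ (number 1 (suc (double n)) - b 1 * number 0 (double n)) ⟩
        number 1 (suc (double n)) - b 1 * number 0 (double n)
          ≡⟨ number-zero (double n) ⟨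
        number 0 (2+ (double n)) ∎
      level-number (suc n) (suc h) = begin
        level (2+ h) (suc n) ≡⟨ level-suc (suc h) n ⟩
        level (suc (2+ h)) n - b (2+ h) * level (2+ h) n + level (suc h) (suc n)
          ≡⟨ cong₂ _+_ (cong₂ (λ x y → x - b (2+ h) * y) (level-number n (2+ h)) (level-number n (suc h)))
               (trans (level-number (suc n) h) (cong (number h) (sum-2+ h))) ⟩
        number (2+ h) (2+ (h ℕ.+ double n)) - b (2+ h) * number (suc h) (suc (h ℕ.+ double n))
          + number h (2+ (h ℕ.+ double n))
          ≡⟨ number-suc h (suc (h ℕ.+ double n)) ⟨
        number (suc h) (suc (2+ (h ℕ.+ double n)))
          ≡⟨ cong (λ x → number (suc h) (suc x)) (sum-2+ h) ⟨
        number (suc h) (suc h ℕ.+ double (suc n)) ∎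
        where
        sum-2+ : ∀ h → h ℕ.+ 2+ (double n) ≡ 2+ (h ℕ.+ double n)
        sum-2+ h = trans (ℕ.+-suc h (suc (double n))) (cong suc (ℕ.+-suc h (double n)))

    count-admissible : ∀ n → count (admissible 0) (allPaths (double n)) ≡ level 1 n
    count-admissible n = sym (level-number n 0)

  double≡2* : ∀ n → double n ≡ 2 ℕ.* n
  double≡2* zero = refl
  double≡2* (suc n) = cong suc (trans (cong suc (double≡2* n)) (sym (ℕ.+-suc n (n ℕ.+ 0))))

  d≡level : ∀ m V n → ℤ.+ d m V n ≡ Levels.level (λ h → indicator (inMV m V h)) 1 n
  d≡level m V n = begin
    ℤ.+ d m V n
      ≡⟨ length-filter-filter (isDyckFrom 0) (avoids m V) (allPaths (2 ℕ.* n)) ⟩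
    count (admissible (inMV m V) 0) (allPaths (2 ℕ.* n))
      ≡⟨ cong (λ k → count (admissible (inMV m V) 0) (allPaths k)) (double≡2* n) ⟨
    count (admissible (inMV m V) 0) (allPaths (double n))
      ≡⟨ count-admissible (inMV m V) n ⟩
    _ ∎

-- Primitive sequences and the integer continuants behind `h`.

module PrimitiveSequences where

  open HankelReduction using (leading)
  open import Data.Nat using (ℕ; zero; suc; 2+; _<_; _≤_; s≤s; z≤n)
  import Data.Nat as ℕ
  import Data.Nat.Properties as ℕ
  open import Data.Nat.ListAction using (sum)
  open import Data.Integer using (ℤ; _+_; _*_; -_; _-_; 0ℤ; 1ℤ; -[1+_]; ∣_∣)
  import Data.Integer as ℤ
  open import Data.Integer.Properties
  open import Data.Integer.Tactic.RingSolver using (solve-∀)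
  open import Data.List using (List; []; _∷_; _∷ʳ_; map; foldr; take; length; upTo)
  open import Data.List.Properties using (map-applyUpTo; length-++)
  open import Data.List.Relation.Unary.All using (All; []; _∷_)
  open import Data.Product using (_×_; _,_; proj₁; proj₂; ∃₂)
  open import Data.Rational using (ℚ; 0ℚ; 1ℚ; toℚᵘ)
  import Data.Rational as ℚ
  import Data.Rational.Properties as ℚ
  open import Data.Rational.Unnormalised using (mkℚᵘ; *≡*; _≃_)
  import Data.Rational.Unnormalised as ℚᵘ
  import Data.Rational.Unnormalised.Properties as ℚᵘ
  open import Function using (_∘_; id)
  open import Relation.Binary.PropositionalEquality
  open import Relation.Nullary using (yes; no; contradiction)
  open ≡-Reasoning

  ι : ℤ → ℚ
  ι z = z ℚ./ 1

  private
    toℚᵘ-ι : ∀ z → toℚᵘ (ι z) ≃ mkℚᵘ z 0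
    toℚᵘ-ι z = ℚ.toℚᵘ-fromℚᵘ (mkℚᵘ z 0)

    +-over-1 : ∀ x y → (x + y) * 1ℤ ≡ (x * 1ℤ + y * 1ℤ) * 1ℤ
    +-over-1 = solve-∀

  ι-+ : ∀ x y → ι (x + y) ≡ ι x ℚ.+ ι y
  ι-+ x y = ℚ.toℚᵘ-injective (ℚᵘ.≃-trans (toℚᵘ-ι (x + y)) (ℚᵘ.≃-trans (*≡* (+-over-1 x y))
    (ℚᵘ.≃-sym (ℚᵘ.≃-trans (ℚ.toℚᵘ-homo-+ (ι x) (ι y)) (ℚᵘ.+-cong (toℚᵘ-ι x) (toℚᵘ-ι y))))))

  ι-* : ∀ x y → ι (x * y) ≡ ι x ℚ.* ι y
  ι-* x y = ℚ.toℚᵘ-injective (ℚᵘ.≃-trans (toℚᵘ-ι (x * y))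
    (ℚᵘ.≃-sym (ℚᵘ.≃-trans (ℚ.toℚᵘ-homo-* (ι x) (ι y)) (ℚᵘ.*-cong (toℚᵘ-ι x) (toℚᵘ-ι y)))))

  ι-neg : ∀ x → ι (- x) ≡ ℚ.- ι x
  ι-neg x = ℚ.toℚᵘ-injective (ℚᵘ.≃-trans (toℚᵘ-ι (- x))
    (ℚᵘ.≃-sym (ℚᵘ.≃-trans (ℚ.toℚᵘ-homo‿- (ι x)) (ℚᵘ.-‿cong (toℚᵘ-ι x)))))

  ι-injective : ∀ x y → ι x ≡ ι y → x ≡ y
  ι-injective x y eq with ℚᵘ.≃-trans (ℚᵘ.≃-sym (toℚᵘ-ι x)) (ℚᵘ.≃-trans (ℚᵘ.≃-reflexive (cong toℚᵘ eq)) (toℚᵘ-ι y))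
  ... | *≡* x*1≡y*1 = trans (sym (*-identityʳ x)) (trans x*1≡y*1 (*-identityʳ y))

  -- Consecutive values of K j = (2 - t j) K (j-1) - K (j-2); with K 0 = 1 and K (-1) = 0 this is the
  -- product h(t₁)⋯h(t₁,…,t j).
  partial-products : ℤ → ℤ → List ℕ → ℤ × ℤ
  partial-products a b [] = a , b
  partial-products a b (t ∷ ts) = partial-products b ((ℤ.+ 2 - ℤ.+ t) * b - a) ts

  inv-* : ∀ x → x ≢ 0ℚ → inv x ℚ.* x ≡ 1ℚ
  inv-* x x≢0 with x ℚ.≟ 0ℚ
  ... | yes x≡0 = contradiction x≡0 x≢0
  ... | no x≢0′ = ℚ.*-inverseˡ x {{ℚ.≢-nonZero x≢0′}}

  -- The hypothesis on `a` and `b` says x = b / a with the denominator cleared, so that the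
  -- recursion of `h` becomes a linear recursion of integers.
  h-step : ∀ t x a b → x ≢ 0ℚ → x ℚ.* ι a ≡ ι b →
    (two ℚ.- ℕtoℚ t ℚ.- inv x) ℚ.* ι b ≡ ι ((ℤ.+ 2 - ℤ.+ t) * b - a)
  h-step t x a b x≢0 eq = begin
    (two ℚ.- ℕtoℚ t ℚ.- inv x) ℚ.* ι b
      ≡⟨ ℚ.*-distribʳ-+ (ι b) (two ℚ.- ℕtoℚ t) (ℚ.- inv x) ⟩
    (two ℚ.- ℕtoℚ t) ℚ.* ι b ℚ.+ (ℚ.- inv x) ℚ.* ι b
      ≡⟨ cong₂ ℚ._+_ (cong (ℚ._* ι b) difference) (trans (sym (ℚ.neg-distribˡ-* (inv x) (ι b))) (cong ℚ.-_ inverse)) ⟩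
    ι (ℤ.+ 2 - ℤ.+ t) ℚ.* ι b ℚ.- ι a
      ≡⟨ cong₂ ℚ._+_ (ι-* (ℤ.+ 2 - ℤ.+ t) b) (ι-neg a) ⟨
    ι ((ℤ.+ 2 - ℤ.+ t) * b) ℚ.+ ι (- a)
      ≡⟨ ι-+ ((ℤ.+ 2 - ℤ.+ t) * b) (- a) ⟨
    ι ((ℤ.+ 2 - ℤ.+ t) * b - a) ∎
    where
    difference : two ℚ.- ℕtoℚ t ≡ ι (ℤ.+ 2 - ℤ.+ t)
    difference = trans (cong (two ℚ.+_) (sym (ι-neg (ℤ.+ t)))) (sym (ι-+ (ℤ.+ 2) (- (ℤ.+ t))))
    inverse : inv x ℚ.* ι b ≡ ι a
    inverse = begin
      inv x ℚ.* ι b           ≡⟨ cong (inv x ℚ.*_) eq ⟨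
      inv x ℚ.* (x ℚ.* ι a)   ≡⟨ ℚ.*-assoc (inv x) x (ι a) ⟨
      inv x ℚ.* x ℚ.* ι a     ≡⟨ cong (ℚ._* ι a) (inv-* x x≢0) ⟩
      1ℚ ℚ.* ι a              ≡⟨ ℚ.*-identityˡ (ι a) ⟩
      ι a ∎

  prefix-product : ℚ → List ℕ → ℚ
  prefix-product x ts = foldr ℚ._*_ 1ℚ (map (λ i → hGo x (take i ts)) (upTo (length ts)))

  prefix-product-∷ : ∀ x t ts →
    prefix-product x (t ∷ ts) ≡ x ℚ.* prefix-product (two ℚ.- ℕtoℚ t ℚ.- inv x) ts
  prefix-product-∷ x t ts = cong (λ l → x ℚ.* foldr ℚ._*_ 1ℚ l)
    (trans (map-applyUpTo suc (λ i → hGo x (take i (t ∷ ts))) (length ts))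
      (sym (map-applyUpTo id (λ i → hGo (two ℚ.- ℕtoℚ t ℚ.- inv x) (take i ts)) (length ts))))

  -- Each value of `h` is a quotient of consecutive continuants, so the product telescopes.
  -- Nonvanishing concerns proper prefixes only, as the last value is never inverted; for a
  -- primitive sequence it is 0.
  hGo-partial-products : ∀ ts x a b → x ℚ.* ι a ≡ ι b →
    (∀ j → j < length ts → hGo x (take j ts) ≢ 0ℚ) →
    hGo x ts ℚ.* ι (proj₁ (partial-products a b ts)) ≡ ι (proj₂ (partial-products a b ts)) ×
    ι a ℚ.* prefix-product x ts ≡ ι (proj₁ (partial-products a b ts))
  hGo-partial-products [] x a b eq _ = eq , ℚ.*-identityʳ (ι a)
  hGo-partial-products (t ∷ ts) x a b eq nonzero
    with hGo-partial-products ts _ b _ (h-step t x a b (nonzero 0 (s≤s z≤n)) eq) (λ j j< → nonzero (suc j) (s≤s j<))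
  ... | last , product = last , (begin
    ι a ℚ.* prefix-product x (t ∷ ts)
      ≡⟨ cong (ι a ℚ.*_) (prefix-product-∷ x t ts) ⟩
    ι a ℚ.* (x ℚ.* prefix-product x′ ts)
      ≡⟨ ℚ.*-assoc (ι a) x (prefix-product x′ ts) ⟨
    ι a ℚ.* x ℚ.* prefix-product x′ ts
      ≡⟨ cong (ℚ._* prefix-product x′ ts) (trans (ℚ.*-comm (ι a) x) eq) ⟩
    ι b ℚ.* prefix-product x′ ts
      ≡⟨ product ⟩
    _ ∎)
    where
    x′ : ℚ
    x′ = two ℚ.- ℕtoℚ t ℚ.- inv x

  private
    bezout-step : ∀ p q a b c → p * a + q * b ≡ (q + p * c) * b + - p * (c * b - a)
    bezout-step = solve-∀
    drop-zero : ∀ p q a → p * a + q * 0ℤ ≡ p * a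
    drop-zero = solve-∀
    initial-pair : ∀ t → (ℤ.+ 2 - t) * 1ℤ - 0ℤ ≡ ℤ.+ 2 - t
    initial-pair = solve-∀

  -- The recursion step has determinant 1, so a Bézout relation is carried along. Once the final
  -- continuant is 0, the relation makes the preceding one a unit.
  partial-products-coprime : ∀ ts a b p q → p * a + q * b ≡ 1ℤ →
    ∃₂ λ p′ q′ → p′ * proj₁ (partial-products a b ts) + q′ * proj₂ (partial-products a b ts) ≡ 1ℤ
  partial-products-coprime [] a b p q eq = p , q , eq
  partial-products-coprime (t ∷ ts) a b p q eq =
    partial-products-coprime ts b _ (q + p * (ℤ.+ 2 - ℤ.+ t)) (- p) (trans (sym (bezout-step p q a b (ℤ.+ 2 - ℤ.+ t))) eq)

  unit-square : ∀ p a → p * a ≡ 1ℤ → a * a ≡ 1ℤ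
  unit-square p a eq = square a (ℕ.m*n≡1⇒n≡1 ∣ p ∣ ∣ a ∣ (trans (sym (abs-* p a)) (cong ∣_∣ eq)))
    where
    square : ∀ a → ∣ a ∣ ≡ 1 → a * a ≡ 1ℤ
    square (ℤ.+ .1) refl = refl
    square -[1+ .0 ] refl = refl

  take-∷ʳ : ∀ (u : List ℕ) t j → j ≤ length u → take j (u ∷ʳ t) ≡ take j u
  take-∷ʳ u t zero _ = refl
  take-∷ʳ (x ∷ u) t (suc j) (s≤s j≤) = cong (x ∷_) (take-∷ʳ u t j j≤)

  length-∷ʳ : ∀ (u : List ℕ) t → length (u ∷ʳ t) ≡ suc (length u)
  length-∷ʳ u t = trans (length-++ u) (ℕ.+-comm (length u) 1)

  primitive-products : ∀ ts → Primitive ts →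
    proj₂ (partial-products 0ℤ 1ℤ ts) ≡ 0ℤ ×
    proj₁ (partial-products 0ℤ 1ℤ ts) * proj₁ (partial-products 0ℤ 1ℤ ts) ≡ 1ℤ ×
    prodH ts ≡ ι (proj₁ (partial-products 0ℤ 1ℤ ts))
  primitive-products [] (u , t , eq , _) = contradiction (trans (cong length eq) (length-∷ʳ u t)) λ ()
  primitive-products ts@(t₁ ∷ rest) (u , t , eq , adm , h≡0) = last≡0 , square , product
    where
    x : ℚ
    x = two ℚ.- ℕtoℚ t₁
    a b : ℤ
    a = proj₁ (partial-products 0ℤ 1ℤ ts)
    b = proj₂ (partial-products 0ℤ 1ℤ ts)
    initial : x ℚ.* ι 1ℤ ≡ ι ((ℤ.+ 2 - ℤ.+ t₁) * 1ℤ - 0ℤ)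
    initial = begin
      x ℚ.* ι 1ℤ ≡⟨ ℚ.*-identityʳ x ⟩
      two ℚ.- ℕtoℚ t₁ ≡⟨ cong (two ℚ.+_) (ι-neg (ℤ.+ t₁)) ⟨
      ι (ℤ.+ 2) ℚ.+ ι (- (ℤ.+ t₁)) ≡⟨ ι-+ (ℤ.+ 2) (- (ℤ.+ t₁)) ⟨
      ι (ℤ.+ 2 - ℤ.+ t₁) ≡⟨ cong ι (initial-pair (ℤ.+ t₁)) ⟨
      ι ((ℤ.+ 2 - ℤ.+ t₁) * 1ℤ - 0ℤ) ∎
    nonzero : ∀ j → j < length rest → hGo x (take j rest) ≢ 0ℚ
    nonzero j j< = subst (λ l → h l ≢ 0ℚ)
      (trans (sym (take-∷ʳ u t (suc j) j<u)) (cong (take (suc j)) (sym eq))) (adm (suc j) (s≤s z≤n) j<u)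
      where
      j<u : j < length u
      j<u = subst (j <_) (ℕ.suc-injective (trans (cong length eq) (length-∷ʳ u t))) j<
    both : hGo x rest ℚ.* ι a ≡ ι b × ι 1ℤ ℚ.* prefix-product x rest ≡ ι a
    both = hGo-partial-products rest x 1ℤ ((ℤ.+ 2 - ℤ.+ t₁) * 1ℤ - 0ℤ) initial nonzero
    last≡0 : b ≡ 0ℤ
    last≡0 = ι-injective b 0ℤ (begin
      ι b ≡⟨ proj₁ both ⟨
      hGo x rest ℚ.* ι a ≡⟨ cong (ℚ._* ι a) (trans (cong h eq) h≡0) ⟩
      0ℚ ℚ.* ι a ≡⟨ ℚ.*-zeroˡ (ι a) ⟩
      0ℚ ∎)
    square : a * a ≡ 1ℤ
    square with partial-products-coprime ts 0ℤ 1ℤ 0ℤ 1ℤ refl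
    ... | p , q , bezout = unit-square p a (begin
      p * a ≡⟨ drop-zero p q a ⟨
      p * a + q * 0ℤ ≡⟨ cong (λ z → p * a + q * z) last≡0 ⟨
      p * a + q * b ≡⟨ bezout ⟩
      1ℤ ∎)
    product : prodH ts ≡ ι a
    product = trans (sym (ℚ.*-identityˡ (prefix-product x rest))) (proj₂ both)

  -- The value at `q` itself is not recorded: each `gap` certifies the mark at its far end, so the
  -- tail starts from a mark already certified.
  data Marks (β : ℕ → ℤ) (q : ℕ) : List ℕ → Set where
    []  : Marks β q []
    gap : ∀ {t ts} → (∀ k → q < k → k < q ℕ.+ t → β k ≡ 0ℤ) → β (q ℕ.+ t) ≡ 1ℤ →
          Marks β (q ℕ.+ t) ts → Marks β q (t ∷ ts)

  private
    linear-start : ∀ a b → b - a ≡ (b - a) - 0ℤ * b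
    linear-start = solve-∀
    linear-second : ∀ a b → - a ≡ (b - a) - (1ℤ + 0ℤ) * b
    linear-second = solve-∀
    linear-step : ∀ a b i →
      (1ℤ + 1ℤ - 0ℤ) * ((b - a) - (1ℤ + i) * b) - ((b - a) - i * b) ≡ (b - a) - (1ℤ + (1ℤ + i)) * b
    linear-step = solve-∀
    at-mark : ∀ a b t → (b - a) - t * b ≡ ((ℤ.+ 2 - t) * b - a) - b
    at-mark = solve-∀
    after-mark : ∀ a b i → (1ℤ + 1ℤ - 1ℤ) * ((b - a) - (1ℤ + i) * b) - ((b - a) - i * b) ≡ - b
    after-mark = solve-∀

  module _ (β : ℕ → ℤ) where

    private
      c : ℕ → ℤ
      c = leading β

    -- Where `β` is 0 the recurrence says that the second difference of the minors vanishes; the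
    -- slope here is `- b`.
    leading-linear : ∀ q t a b → c q ≡ b - a → c (suc q) ≡ - a →
      (∀ k → q < k → k < q ℕ.+ t → β k ≡ 0ℤ) → ∀ i → suc i ≤ t →
      c (q ℕ.+ i) ≡ (b - a) - ℤ.+ i * b × c (suc (q ℕ.+ i)) ≡ (b - a) - ℤ.+ (suc i) * b
    leading-linear q t a b cq cq⁺ zeros zero _ =
      trans (cong c (ℕ.+-identityʳ q)) (trans cq (linear-start a b)) ,
      trans (cong (c ∘ suc) (ℕ.+-identityʳ q)) (trans cq⁺ (linear-second a b))
    leading-linear q t a b cq cq⁺ zeros (suc i) i+2≤t
      with leading-linear q t a b cq cq⁺ zeros i (ℕ.<⇒≤ i+2≤t)
    ... | now , next = trans (cong c (ℕ.+-suc q i)) next , (begin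
      c (suc (q ℕ.+ suc i)) ≡⟨ cong (c ∘ suc) (ℕ.+-suc q i) ⟩
      (1ℤ + 1ℤ - β (suc (q ℕ.+ i))) * c (suc (q ℕ.+ i)) - c (q ℕ.+ i)
        ≡⟨ cong₂ _-_ (cong₂ (λ u v → (1ℤ + 1ℤ - u) * v)
             (zeros _ (s≤s (ℕ.m≤m+n q i)) (subst (_< q ℕ.+ t) (ℕ.+-suc q i) (ℕ.+-monoʳ-< q i+2≤t))) next) now ⟩
      (1ℤ + 1ℤ - 0ℤ) * ((b - a) - ℤ.+ (suc i) * b) - ((b - a) - ℤ.+ i * b)
        ≡⟨ linear-step a b (ℤ.+ i) ⟩
      (b - a) - ℤ.+ (2+ i) * b ∎)

    -- A mark lowers the slope by the minor at that place. The slope thus passes from `- b` to minus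
    -- the next entry of `partial-products`, and the two minors at the new mark have the shape
    -- `b - a`, `- a` for the new pair.
    leading-Marks : ∀ q ts a b → c q ≡ b - a → c (suc q) ≡ - a → All (1 ≤_) ts → Marks β q ts →
      c (q ℕ.+ sum ts) ≡ proj₂ (partial-products a b ts) - proj₁ (partial-products a b ts) ×
      c (suc (q ℕ.+ sum ts)) ≡ - proj₁ (partial-products a b ts)
    leading-Marks q [] a b cq cq⁺ _ _ =
      trans (cong c (ℕ.+-identityʳ q)) cq , trans (cong (c ∘ suc) (ℕ.+-identityʳ q)) cq⁺
    leading-Marks q (suc t ∷ ts) a b cq cq⁺ (_ ∷ positive) (gap zeros mark marks)
      with leading-linear q (suc t) a b cq cq⁺ zeros t ℕ.≤-refl
    ... | now , next with leading-Marks (q ℕ.+ suc t) ts b b′ here there positive marks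
      where
      b′ : ℤ
      b′ = (ℤ.+ 2 - ℤ.+ (suc t)) * b - a
      here : c (q ℕ.+ suc t) ≡ b′ - b
      here = trans (cong c (ℕ.+-suc q t)) (trans next (at-mark a b (ℤ.+ (suc t))))
      there : c (suc (q ℕ.+ suc t)) ≡ - b
      there = begin
        c (suc (q ℕ.+ suc t)) ≡⟨ cong (c ∘ suc) (ℕ.+-suc q t) ⟩
        (1ℤ + 1ℤ - β (suc (q ℕ.+ t))) * c (suc (q ℕ.+ t)) - c (q ℕ.+ t)
          ≡⟨ cong₂ _-_ (cong₂ (λ u v → (1ℤ + 1ℤ - u) * v) (trans (cong β (sym (ℕ.+-suc q t))) mark) next) now ⟩
        (1ℤ + 1ℤ - 1ℤ) * ((b - a) - ℤ.+ (suc t) * b) - ((b - a) - ℤ.+ t * b)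
          ≡⟨ after-mark a b (ℤ.+ t) ⟩
        - b ∎
    ...   | at , after =
      trans (cong c (sym (ℕ.+-assoc q (suc t) (sum ts)))) at ,
      trans (cong (c ∘ suc) (sym (ℕ.+-assoc q (suc t) (sum ts)))) after

    leading-initial : ∀ s → (∀ k → 1 ≤ k → k < s → β k ≡ 0ℤ) → ∀ i → i < s → c i ≡ 1ℤ × c (suc i) ≡ 1ℤ
    leading-initial s zeros zero _ = refl , refl
    leading-initial s zeros (suc i) i+1<s with leading-initial s zeros i (ℕ.<⇒≤ i+1<s)
    ... | now , next = next ,
      cong₂ _-_ (cong₂ (λ u v → (1ℤ + 1ℤ - u) * v) (zeros (suc i) (s≤s z≤n) i+1<s) next) now

    -- All minors up to the first mark are 1, and that mark makes the next one 0: the state of the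
    -- pair (0, 1). At the end the second continuant is 0, so the two minors agree, as `stationary`
    -- demands.
    leading-primitive : ∀ s ts → (∀ k → 1 ≤ k → k < suc s → β k ≡ 0ℤ) → β (suc s) ≡ 1ℤ →
      All (1 ≤_) ts → Marks β (suc s) ts → proj₂ (partial-products 0ℤ 1ℤ ts) ≡ 0ℤ →
      c (suc s ℕ.+ sum ts) ≡ - proj₁ (partial-products 0ℤ 1ℤ ts) ×
      c (suc (suc s ℕ.+ sum ts)) ≡ - proj₁ (partial-products 0ℤ 1ℤ ts)
    leading-primitive s ts zeros mark positive marks last≡0
      with leading-initial (suc s) zeros s ℕ.≤-refl
    ... | now , next with leading-Marks (suc s) ts 0ℤ 1ℤ next second positive marks
      where
      second : c (2+ s) ≡ 0ℤ
      second = cong₂ _-_ (cong₂ (λ u v → (1ℤ + 1ℤ - u) * v) mark next) now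
    ... | here , there =
      trans here (trans (cong (_- proj₁ (partial-products 0ℤ 1ℤ ts)) last≡0) (+-identityˡ _)) , there

-- Arithmetic of the forbidden heights modulo m.

module ForbiddenHeights where

  open LevelSeries using (double)
  open PathCounting using (indicator; double≡2*)
  open PrimitiveSequences using (Marks; []; gap)
  open import Data.Bool using (Bool; true; false; _∨_)
  open import Data.Bool.Properties using (∨-zeroʳ)
  open import Data.Bool.ListAction using (any)
  open import Data.Integer using (ℤ; 0ℤ; 1ℤ)
  open import Data.List using (List; []; _∷_; map; take; length; upTo; applyUpTo)
  open import Data.List.Properties using (map-applyUpTo; map-cong)
  open import Data.List.Membership.Propositional using (_∈_)
  open import Data.List.Membership.Propositional.Properties using (∈-map⁺; ∈-map⁻)
  open import Data.List.Relation.Unary.All as All using (All; []; _∷_)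
  open import Data.List.Relation.Unary.Any using (here; there)
  open import Data.Nat using (ℕ; zero; suc; _+_; _∸_; _*_; _<_; _≤_; _%_; _/_; s≤s; z≤n; _≡ᵇ_)
  open import Data.Nat.DivMod using (m<n⇒m%n≡m; n%n≡0; [m+n]%n≡m%n; m≡m%n+[m/n]*n)
  open import Data.Nat.ListAction using (sum)
  open import Data.Nat.Properties
  open import Data.Product using (_×_; _,_)
  open import Data.Sum using (_⊎_; inj₁; inj₂)
  open import Function using (_∘_; id)
  open import Relation.Binary.PropositionalEquality
  open import Relation.Nullary using (yes; no; contradiction; ¬_)
  open ≡-Reasoning

  positions : ℕ → List ℕ → List ℕ
  positions q [] = q ∷ []
  positions q (t ∷ ts) = q ∷ positions (q + t) ts

  positions-≥ : ∀ q ts {x} → x ∈ positions q ts → q ≤ x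
  positions-≥ q [] (here refl) = ≤-refl
  positions-≥ q (t ∷ ts) (here refl) = ≤-refl
  positions-≥ q (t ∷ ts) (there x∈) = ≤-trans (m≤m+n q t) (positions-≥ (q + t) ts x∈)

  positions-≤ : ∀ q ts {x} → x ∈ positions q ts → x ≤ q + sum ts
  positions-≤ q [] (here refl) = m≤m+n q 0
  positions-≤ q (t ∷ ts) (here refl) = m≤m+n q (t + sum ts)
  positions-≤ q (t ∷ ts) (there x∈) = ≤-trans (positions-≤ (q + t) ts x∈) (≤-reflexive (+-assoc q t (sum ts)))

  first∈positions : ∀ q ts → q ∈ positions q ts
  first∈positions q [] = here refl
  first∈positions q (t ∷ ts) = here refl

  last∈positions : ∀ q ts → q + sum ts ∈ positions q ts
  last∈positions q [] = here (+-identityʳ q)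
  last∈positions q (t ∷ ts) =
    there (subst (_∈ positions (q + t) ts) (+-assoc q t (sum ts)) (last∈positions (q + t) ts))

  Vset-positions : ∀ s ts → Vset s ts ≡ map double (positions s ts)
  Vset-positions s [] = cong (_∷ []) (sym (trans (double≡2* s) (cong (2 *_) (sym (+-identityʳ s)))))
  Vset-positions s (t ∷ ts) = cong₂ _∷_
    (sym (trans (double≡2* s) (cong (2 *_) (sym (+-identityʳ s)))))
    (begin
      map (λ i → 2 * (s + sum (take i (t ∷ ts)))) (applyUpTo suc (suc (length ts)))
        ≡⟨ map-applyUpTo suc (λ i → 2 * (s + sum (take i (t ∷ ts)))) (suc (length ts)) ⟩
      applyUpTo (λ i → 2 * (s + (t + sum (take i ts)))) (suc (length ts))
        ≡⟨ map-applyUpTo id (λ i → 2 * (s + (t + sum (take i ts)))) (suc (length ts)) ⟨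
      map (λ i → 2 * (s + (t + sum (take i ts)))) (upTo (suc (length ts)))
        ≡⟨ map-cong (λ i → cong (2 *_) (sym (+-assoc s t (sum (take i ts))))) (upTo (suc (length ts))) ⟩
      Vset (s + t) ts
        ≡⟨ Vset-positions (s + t) ts ⟩
      map double (positions (s + t) ts) ∎)

  marks-positions : ∀ (β : ℕ → ℤ) q ts → All (1 ≤_) ts → (∀ x → x ∈ positions q ts → β x ≡ 1ℤ) →
    (∀ k → q < k → k ≤ q + sum ts → ¬ (k ∈ positions q ts) → β k ≡ 0ℤ) → Marks β q ts
  marks-positions β q [] _ mark zeros = []
  marks-positions β q (t ∷ ts) (1≤t ∷ positive) mark zeros = gap
    (λ k q<k k<q+t → zeros k q<k
      (≤-trans (<⇒≤ k<q+t) (≤-trans (m≤m+n (q + t) (sum ts)) (≤-reflexive (+-assoc q t (sum ts)))))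
      λ { (here refl) → <-irrefl refl q<k
        ; (there k∈) → <⇒≱ k<q+t (positions-≥ (q + t) ts k∈) })
    (mark (q + t) (there (first∈positions (q + t) ts)))
    (marks-positions β (q + t) ts positive (λ x x∈ → mark x (there x∈))
      (λ k q+t<k k≤ k∉ → zeros k (≤-<-trans (m≤m+n q t) q+t<k) (≤-trans k≤ (≤-reflexive (+-assoc q t (sum ts))))
        λ { (here refl) → <⇒≱ q+t<k (m≤m+n q t) ; (there k∈) → k∉ k∈ }))

  double-mono-≤ : ∀ {m n} → m ≤ n → double m ≤ double n
  double-mono-≤ z≤n = z≤n
  double-mono-≤ (s≤s m≤n) = s≤s (s≤s (double-mono-≤ m≤n))

  double-cancel-≤ : ∀ m n → double m ≤ double n → m ≤ n
  double-cancel-≤ zero n _ = z≤n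
  double-cancel-≤ (suc m) (suc n) (s≤s (s≤s le)) = s≤s (double-cancel-≤ m n le)

  double-injective : ∀ m n → double m ≡ double n → m ≡ n
  double-injective m n eq =
    ≤-antisym (double-cancel-≤ m n (≤-reflexive eq)) (double-cancel-≤ n m (≤-reflexive (sym eq)))

  odd≢even : ∀ m n → suc (double m) ≢ double n
  odd≢even m zero ()
  odd≢even (suc m) (suc n) eq = odd≢even m n (suc-injective (suc-injective eq))

  n≤double : ∀ n → n ≤ double n
  n≤double zero = z≤n
  n≤double (suc n) = s≤s (m≤n⇒m≤1+n (n≤double n))

  double≡+ : ∀ n → double n ≡ n + n
  double≡+ n = trans (double≡2* n) (cong (n +_) (+-identityʳ n))

  private
    ≡ᵇ-true : ∀ {m n} → m ≡ n → (m ≡ᵇ n) ≡ true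
    ≡ᵇ-true {zero} refl = refl
    ≡ᵇ-true {suc m} refl = ≡ᵇ-true {m} refl

    ≡ᵇ-false : ∀ m n → m ≢ n → (m ≡ᵇ n) ≡ false
    ≡ᵇ-false zero zero m≢n = contradiction refl m≢n
    ≡ᵇ-false zero (suc n) _ = refl
    ≡ᵇ-false (suc m) zero _ = refl
    ≡ᵇ-false (suc m) (suc n) m≢n = ≡ᵇ-false m n (m≢n ∘ cong suc)

    ≡ᵇ⇒≡′ : ∀ m n → (m ≡ᵇ n) ≡ true → m ≡ n
    ≡ᵇ⇒≡′ zero zero _ = refl
    ≡ᵇ⇒≡′ (suc m) (suc n) eq = cong suc (≡ᵇ⇒≡′ m n eq)

    any-true : ∀ (f : ℕ → Bool) {xs x} → x ∈ xs → f x ≡ true → any f xs ≡ true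
    any-true f {x ∷ xs} (here refl) fx = cong (_∨ any f xs) fx
    any-true f {y ∷ xs} (there x∈) fx = trans (cong (f y ∨_) (any-true f x∈ fx)) (∨-zeroʳ (f y))

    any-false : ∀ (f : ℕ → Bool) xs → (∀ x → x ∈ xs → f x ≡ false) → any f xs ≡ false
    any-false f [] _ = refl
    any-false f (x ∷ xs) none = cong₂ _∨_ (none x (here refl)) (any-false f xs λ y y∈ → none y (there y∈))

    any-cong : ∀ {f g : ℕ → Bool} → (∀ x → f x ≡ g x) → ∀ xs → any f xs ≡ any g xs
    any-cong eq [] = refl
    any-cong eq (x ∷ xs) = cong₂ _∨_ (eq x) (any-cong eq xs)

  -- Representatives run from 1 to the modulus, not from 0, because the largest element of V may
  -- equal m.
  residue-injective : ∀ m {x y} → 1 ≤ x → x ≤ suc m → 1 ≤ y → y ≤ suc m → x % suc m ≡ y % suc m → x ≡ y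
  residue-injective m {x} {y} 1≤x x≤ 1≤y y≤ eq with m≤n⇒m<n∨m≡n x≤ | m≤n⇒m<n∨m≡n y≤
  ... | inj₁ x< | inj₁ y< = trans (sym (m<n⇒m%n≡m x<)) (trans eq (m<n⇒m%n≡m y<))
  ... | inj₁ x< | inj₂ refl =
    contradiction (trans (sym (m<n⇒m%n≡m x<)) (trans eq (n%n≡0 (suc m)))) (m<n⇒n≢0 1≤x)
  ... | inj₂ refl | inj₁ y< =
    contradiction (trans (sym (m<n⇒m%n≡m y<)) (trans (sym eq) (n%n≡0 (suc m)))) (m<n⇒n≢0 1≤y)
  ... | inj₂ refl | inj₂ refl = refl

  -- In both cases `double p` is a multiple of m, namely m or 2m. Oddness is stated through `double`
  -- because `b-even-free` refutes an explicit half.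
  HalfPeriod : ℕ → ℕ → Set
  HalfPeriod m p = m ≡ double p ⊎ (m ≡ p × ∀ j → m ≢ double j)

  halfPeriod : ∀ m → HalfPeriod m (pOf m)
  halfPeriod m with m % 2 ≡ᵇ 0 in eq
  ... | true = inj₁ (begin
    m                   ≡⟨ m≡m%n+[m/n]*n m 2 ⟩
    m % 2 + (m / 2) * 2 ≡⟨ cong (_+ (m / 2) * 2) (≡ᵇ⇒≡′ (m % 2) 0 eq) ⟩
    (m / 2) * 2         ≡⟨ *-comm (m / 2) 2 ⟩
    2 * (m / 2)         ≡⟨ double≡2* (m / 2) ⟨
    double (m / 2) ∎)
  ... | false = inj₂ (refl , λ j m≡2j → contradiction (trans (sym eq) (≡ᵇ-true (even j m≡2j))) λ ())
    where
    even : ∀ j → m ≡ double j → m % 2 ≡ 0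
    even j refl = double%2 j
      where
      double%2 : ∀ j → double j % 2 ≡ 0
      double%2 zero = refl
      double%2 (suc j) = trans (cong (_% 2) (+-comm 2 (double j))) (trans ([m+n]%n≡m%n (double j) 2) (double%2 j))

  module _ (m′ p s′ : ℕ) (ts : List ℕ) (half : HalfPeriod (suc m′) p)
    (bounded : All (_≤ suc m′) (Vset (suc s′) ts)) where

    private
      m s r : ℕ
      m = suc m′
      s = suc s′
      r = s + sum ts
      V : List ℕ
      V = Vset s ts

    forbidden : ℕ → ℤ
    forbidden h = indicator (inMV m V h)

    private
      b : ℕ → ℤ
      b = forbidden

      double∈V : ∀ {q} → q ∈ positions s ts → double q ∈ V
      double∈V q∈ = subst (_ ∈_) (sym (Vset-positions s ts)) (∈-map⁺ double q∈)

      V≤m : ∀ {q} → q ∈ positions s ts → double q ≤ m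
      V≤m q∈ = All.lookup bounded (double∈V q∈)

      2r≤m : double r ≤ m
      2r≤m = V≤m (last∈positions s ts)

      positive : ∀ {q} → q ∈ positions s ts → 1 ≤ double q
      positive {q} q∈ = ≤-trans (≤-trans (s≤s z≤n) (positions-≥ s ts q∈)) (n≤double q)

    b-one : ∀ q → q ∈ positions s ts → b (double q) ≡ 1ℤ
    b-one zero q∈ = contradiction (positions-≥ s ts q∈) λ ()
    b-one (suc q) q∈ = cong indicator
      (any-true (congMod m (double (suc q))) (double∈V q∈) (≡ᵇ-true {double (suc q) % m} refl))

    b-zero : ∀ h → 1 ≤ h → (∀ q → q ∈ positions s ts → h % m ≢ double q % m) → b h ≡ 0ℤ
    b-zero (suc h) _ avoid = cong indicator (any-false (congMod m (suc h)) V none)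
      where
      none : ∀ v → v ∈ V → congMod m (suc h) v ≡ false
      none v v∈ with ∈-map⁻ double (subst (v ∈_) (Vset-positions s ts) v∈)
      ... | q , q∈ , refl = ≡ᵇ-false _ _ (avoid q q∈)

    b-zero-≤ : ∀ h → 1 ≤ h → h ≤ m → (∀ q → q ∈ positions s ts → h ≢ double q) → b h ≡ 0ℤ
    b-zero-≤ h 1≤h h≤m avoid = b-zero h 1≤h λ q q∈ eq →
      avoid q q∈ (residue-injective m′ 1≤h h≤m (positive q∈) (V≤m q∈) eq)

    b-even-zero : ∀ k → 1 ≤ k → double k ≤ m → ¬ (k ∈ positions s ts) → b (double k) ≡ 0ℤ
    b-even-zero k 1≤k 2k≤m k∉ = b-zero-≤ (double k) (≤-trans 1≤k (n≤double k)) 2k≤m λ q q∈ eq →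
      k∉ (subst (_∈ positions s ts) (sym (double-injective k q eq)) q∈)

    r≤p : r ≤ p
    r≤p = by half
      where
      by : HalfPeriod m p → r ≤ p
      by (inj₁ m≡2p) = double-cancel-≤ r p (≤-trans 2r≤m (≤-reflexive m≡2p))
      by (inj₂ (m≡p , _)) = ≤-trans (n≤double r) (≤-trans 2r≤m (≤-reflexive m≡p))

    b-periodic : ∀ h → b (double p + suc h) ≡ b (suc h)
    b-periodic h = cong indicator (trans (cong (inMV m V) (+-suc (double p) h))
      (any-cong (λ v → cong (_≡ᵇ v % m) (residue half)) V))
      where
      swap : suc (double p + h) ≡ suc h + double p
      swap = trans (sym (+-suc (double p) h)) (+-comm (double p) (suc h))
      residue : HalfPeriod m p → suc (double p + h) % m ≡ suc h % m
      residue (inj₁ m≡2p) = trans (cong (_% m) (trans swap (cong (suc h +_) (sym m≡2p)))) ([m+n]%n≡m%n (suc h) m)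
      residue (inj₂ (m≡p , _)) = begin
        suc (double p + h) % m
          ≡⟨ cong (_% m) (trans swap (trans (cong (suc h +_) (trans (double≡+ p) (sym (cong₂ _+_ m≡p m≡p)))) (sym (+-assoc (suc h) m m)))) ⟩
        (suc h + m + m) % m ≡⟨ [m+n]%n≡m%n (suc h + m) m ⟩
        (suc h + m) % m ≡⟨ [m+n]%n≡m%n (suc h) m ⟩
        suc h % m ∎

    -- These heights are below `double r`, hence at most m, and up to m the forbidden heights are
    -- exactly the elements of V, all even. For odd m this parity breaks down above m.
    b-odd-free : ∀ k → k < r → b (suc (double k)) ≡ 0ℤ
    b-odd-free k k<r = b-zero-≤ (suc (double k)) (s≤s z≤n)
      (≤-trans (≤-trans (n≤1+n _) (double-mono-≤ k<r)) 2r≤m) λ q _ → odd≢even k q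

    -- Heights up to m lie beyond the last mark. Those above m occur for odd m only; reduced by m
    -- they become odd and so avoid V.
    b-even-free : ∀ k → r ≤ k → k < p → b (double (suc k)) ≡ 0ℤ
    b-even-free k r≤k k<p with double (suc k) ≤? m
    ... | yes ≤m = b-even-zero (suc k) (s≤s z≤n) ≤m λ k∈ → <⇒≱ (s≤s r≤k) (positions-≤ s ts k∈)
    ... | no ≰m = by half
      where
      m<2k : m < double (suc k)
      m<2k = ≰⇒> ≰m
      e : ℕ
      e = double (suc k) ∸ m
      2k≡e+m : double (suc k) ≡ e + m
      2k≡e+m = sym (m∸n+n≡m (<⇒≤ m<2k))
      1≤e : 1 ≤ e
      1≤e = m<n⇒0<n∸m m<2k
      e≤m : m ≡ p → e ≤ m
      e≤m m≡p = m≤n+o⇒m∸n≤o (double (suc k)) m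
        (≤-trans (double-mono-≤ k<p) (≤-reflexive (trans (double≡+ p) (sym (cong₂ _+_ m≡p m≡p)))))
      avoid : m ≡ p → (∀ j → m ≢ double j) → ∀ q → q ∈ positions s ts → double (suc k) % m ≢ double q % m
      -- A common residue would force `e ≡ double q`, making m a difference of two even numbers.
      avoid m≡p odd q q∈ eq = odd (suc k ∸ q) (begin
        m ≡⟨ m+n∸m≡n e m ⟨
        e + m ∸ e ≡⟨ cong₂ _∸_ (sym 2k≡e+m) e≡2q ⟩
        double (suc k) ∸ double q ≡⟨ double-∸ (suc k) q ⟨
        double (suc k ∸ q) ∎)
        where
        e≡2q : e ≡ double q
        e≡2q = residue-injective m′ 1≤e (e≤m m≡p) (positive q∈) (V≤m q∈)
          (trans (sym ([m+n]%n≡m%n e m)) (trans (cong (_% m) (sym 2k≡e+m)) eq))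
        double-∸ : ∀ i j → double (i ∸ j) ≡ double i ∸ double j
        double-∸ i zero = refl
        double-∸ zero (suc j) = refl
        double-∸ (suc i) (suc j) = double-∸ i j
      by : HalfPeriod m p → b (double (suc k)) ≡ 0ℤ
      by (inj₁ m≡2p) = contradiction (≤-trans (double-mono-≤ k<p) (≤-reflexive (sym m≡2p))) ≰m
      by (inj₂ (m≡p , odd)) = b-zero (double (suc k)) (s≤s z≤n) (avoid m≡p odd)

    b-initial : ∀ k → 1 ≤ k → k < s → b (double k) ≡ 0ℤ
    b-initial k 1≤k k<s = b-even-zero k 1≤k
      (≤-trans (double-mono-≤ (≤-trans (<⇒≤ k<s) (m≤m+n s (sum ts)))) 2r≤m)
      λ k∈ → <⇒≱ k<s (positions-≥ s ts k∈)

    b-marks : All (1 ≤_) ts → Marks (λ k → b (double k)) s ts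
    b-marks 1≤ts = marks-positions (λ k → b (double k)) s ts 1≤ts b-one
      λ k s<k k≤r k∉ → b-even-zero k (≤-<-trans z≤n s<k) (≤-trans (double-mono-≤ k≤r) 2r≤m) k∉

-- From the shift factor to the period.

module HankelPeriods where

  open Determinants using (Det; det≡Det)
  open LevelSeries using (module Levels)
  open HankelReduction using (leading; Hankel-shift)
  open PathCounting using (d≡level)
  open PrimitiveSequences
  open ForbiddenHeights
  open import Data.Fin using (toℕ)
  open import Data.Integer using (ℤ; _*_; -_; 1ℤ; -1ℤ)
  open import Data.Integer.Properties
    using (*-assoc; *-identityˡ; neg-distribˡ-*; neg-distribʳ-*; neg-involutive)
  open import Data.List.Relation.Unary.All using (All)
  open import Data.Nat using (ℕ; suc; _+_; _≤_)
  import Data.Nat as ℕ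
  open import Data.Nat.ListAction using (sum)
  open import Data.Nat.Properties using (+-comm; +-assoc; +-identityʳ; m≤n⇒∃[o]m+o≡n; m≤n⇒m≤n+o)
  open import Data.Product using (∃; _×_; _,_; proj₁)
  open import Data.Rational using (1ℚ)
  import Data.Rational as ℚ
  open import Relation.Binary.PropositionalEquality
  open ≡-Reasoning

  ShiftFactor : (ℕ → ℤ) → ℕ → ℤ → Set
  ShiftFactor a q ε = ∀ n → 1 ≤ n → a (n + q) ≡ ε * a n

  shiftFactor-one : ∀ {a q} → ShiftFactor a q 1ℤ → HasPeriod a q
  shiftFactor-one {a} factor n 1≤n = trans (factor n 1≤n) (*-identityˡ (a n))

  shiftFactor-double : ∀ {a q ε} → ε * ε ≡ 1ℤ → ShiftFactor a q ε → HasPeriod a (2 ℕ.* q)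
  shiftFactor-double {a} {q} {ε} square factor n 1≤n = begin
    a (n + (q + (q + 0)))
      ≡⟨ cong a (trans (cong (λ x → n + (q + x)) (+-identityʳ q)) (sym (+-assoc n q q))) ⟩
    a (n + q + q)     ≡⟨ factor (n + q) (m≤n⇒m≤n+o q 1≤n) ⟩
    ε * a (n + q)     ≡⟨ cong (ε *_) (factor n 1≤n) ⟩
    ε * (ε * a n)     ≡⟨ *-assoc ε ε (a n) ⟨
    ε * ε * a n       ≡⟨ cong (_* a n) square ⟩
    1ℤ * a n          ≡⟨ *-identityˡ (a n) ⟩
    a n ∎

  private
    neg-square : ∀ a → - a * - a ≡ a * a
    neg-square a = trans (sym (neg-distribˡ-* a (- a)))
      (trans (cong -_ (sym (neg-distribʳ-* a a))) (neg-involutive (a * a)))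

  HD-shiftFactor : ∀ m′ p s′ ts → HalfPeriod (suc m′) p → All (1 ≤_) ts →
    All (_≤ suc m′) (Vset (suc s′) ts) → Primitive ts →
    ∃ λ ε → ε * ε ≡ 1ℤ × ShiftFactor (HD (suc m′) (Vset (suc s′) ts)) p ε × (prodH ts ≡ ℚ.- 1ℚ → ε ≡ 1ℤ)
  HD-shiftFactor m′ p s′ ts half 1≤ts bounded prim
    with primitive-products ts prim | m≤n⇒∃[o]m+o≡n (r≤p m′ p s′ ts half bounded)
  -- `k` counts the free levels from `r` up to `p`, and `- a` is the common value of the minors of
  -- sizes `r` and `suc r`.
  ... | last≡0 , square , product | k , refl = - a , unit , factor , λ prod≡-1 →
    cong -_ (ι-injective a -1ℤ (trans (sym product) prod≡-1))
    where
    a : ℤ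
    a = proj₁ (partial-products (ℤ.pos 0) 1ℤ ts)
    r : ℕ
    r = suc s′ + sum ts
    b : ℕ → ℤ
    b = forbidden m′ p s′ ts half bounded
    c : ℕ → ℤ
    c = leading (λ k → b (LevelSeries.double k))
    open Levels b using (level)
    unit : - a * - a ≡ 1ℤ
    unit = trans (neg-square a) square
    at-end : c r ≡ - a × c (suc r) ≡ - a
    at-end = leading-primitive (λ k → b (LevelSeries.double k)) s′ ts
      (b-initial m′ p s′ ts half bounded)
      (b-one m′ p s′ ts half bounded (suc s′) (first∈positions (suc s′) ts))
      1≤ts (b-marks m′ p s′ ts half bounded 1≤ts) last≡0
    hankel≡Det : ∀ n → HD (suc m′) (Vset (suc s′) ts) n ≡ Det n (λ i j → level 1 (i + j))
    hankel≡Det n = det≡Det n (λ i j → d≡level (suc m′) (Vset (suc s′) ts) (toℕ i + toℕ j))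
    factor : ShiftFactor (HD (suc m′) (Vset (suc s′) ts)) (r + k) (- a)
    factor (suc n) _ with at-end
    ... | cr≡-a , cr⁺≡-a = begin
      HD (suc m′) (Vset (suc s′) ts) (suc n + (r + k))
        ≡⟨ hankel≡Det (suc n + (r + k)) ⟩
      Det (suc n + (r + k)) (λ i j → level 1 (i + j))
        ≡⟨ cong (λ x → Det (suc x) (λ i j → level 1 (i + j))) (+-comm n (r + k)) ⟩
      Det (suc (r + k + n)) (λ i j → level 1 (i + j))
        ≡⟨ Hankel-shift b (s′ + sum ts) k (b-periodic m′ p s′ ts half bounded)
             (b-odd-free m′ p s′ ts half bounded) (b-even-free m′ p s′ ts half bounded)
             (trans cr⁺≡-a (sym cr≡-a)) (trans (cong₂ _*_ cr≡-a cr≡-a) unit) n ⟩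
      c r * Det (suc n) (λ i j → level 1 (i + j))
        ≡⟨ cong₂ _*_ cr≡-a (sym (hankel≡Det (suc n))) ⟩
      - a * HD (suc m′) (Vset (suc s′) ts) (suc n) ∎

open HankelPeriods using (HD-shiftFactor; shiftFactor-one; shiftFactor-double; ShiftFactor)
open ForbiddenHeights using (halfPeriod)
open import Data.Integer using (ℤ)
open import Data.Nat using (ℕ; suc; _≤_; _∸_; _*_)
open import Data.List using (List; length)
open import Data.List.Relation.Unary.All using (All; _∷_)
open import Data.Rational using (ℚ; 1ℚ; -_)
open import Data.Sum using (_⊎_; inj₂)
open import Data.Product using (_×_; _,_)
open import Relation.Binary.PropositionalEquality using (_≡_; subst)

theorem1p4 : (ℓ : ℕ) → 2 ≤ ℓ → (ts : List ℕ) → length ts ≡ ℓ ∸ 1 → All (1 ≤_) ts →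
    (s : ℕ) → 1 ≤ s → (m : ℕ) → All (_≤ m) (Vset s ts) → Primitive ts →
    (HasPeriod (HD m (Vset s ts)) (pOf m) ⊎ HasPeriod (HD m (Vset s ts)) (2 * pOf m))
    × (prodH ts ≡ - 1ℚ → HasPeriod (HD m (Vset s ts)) (pOf m))
    × (prodH ts ≡ 1ℚ → HasPeriod (HD m (Vset s ts)) (2 * pOf m))
theorem1p4 ℓ 2≤ℓ ts len positive (suc s) 1≤s (suc m) bounded prim
  with HD-shiftFactor m (pOf (suc m)) s ts (halfPeriod (suc m)) positive bounded prim
... | ε , square , factor , ε≡1 =
  -- Two shifts multiply by `ε * ε`, so `2 * p` is a period for either sign; product -1 gives
  -- `ε ≡ 1` and sharpens it to `p`.
  inj₂ twice ,
  (λ prod≡-1 → shiftFactor-one {a} {p} (subst (ShiftFactor a p) (ε≡1 prod≡-1) factor)) ,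
  (λ _ → twice)
  where
  a : ℕ → ℤ
  a = HD (suc m) (Vset (suc s) ts)
  p : ℕ
  p = pOf (suc m)
  twice : HasPeriod a (2 * p)
  twice = shiftFactor-double {a} {p} {ε} square factor
theorem1p4 ℓ 2≤ℓ ts len positive (suc s) 1≤s 0 (() ∷ bounded) prim
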